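{- Let $(W,S)$ be a Coxeter system of finite rank and $u,v\in W$ with $u\leq_R v$. Then the Coxeter complex $C(u,v)$ is linearly shellable.
   Context: $\ell$ is the length function; $u\le_R v$ iff $\ell(v)=\ell(u)+\ell(u^{ -1}v)$; $[u,v]_R=\{w:u\le_R w\le_R v\}$. For $J\subseteq S$, $W^J=\{x:\ell(x)<\ell(xs)\ \forall s\in J\}$, each $x=x^Jx_J$ uniquely with $x^J\in W^J$, $x_J\in\langle J\rangle$, lengths adding; $P^{(s)}(x):=x^{S\setminus\{s\}}$; $P(w):=\{(P^{(s)}(w),s):s\in S\}$. $C(u,v)$ is the pure simplicial complex of dimension $|S|-1$ with facets $P(w)$, $w\in[u,v]_R$ (vertex set $\bigcup_{w}P(w)$). For a pure simplicial complex $X$ of dimension $d$ with $n$ vertices: a bijection $\sigma:V(X)\to[n]$ induces $\sigma_X:X\to[n]^{d+1}_<$ (facets as increasing $(d+1)$-tuples); $[n]^{d+1}_<$ carries the componentwise (Bruhat/Gale) order $x\le y$ iff $x_i\le y_i$ for all $i$. A sequence $(C_1,\dots,C_h)$ of distinct elements of $[n]^k_<$ (viewed as $k$-subsets) is a shelling order if for all $i<j$ there is $r<j$ with $C_r=C_j+\{a,b\}$ (symmetric difference), $a\in C_j\setminus C_i$, $b\in C_r\setminus C_j$. $X$ is linearly shellable if some such $\sigma$ makes the induced subposet $\operatorname{im}(\sigma_X)\subseteq[n]^{d+1}_<$ have a linear extension which is a shelling order. -}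

module Defs where

open import Data.Nat as ℕ using (ℕ; zero; suc; _+_)
open import Data.Fin as Fin using (Fin)
open import Data.List using (List; []; _∷_; _++_; length; reverse; concat; replicate; [_])
open import Data.List.Relation.Unary.All using (All)
open import Data.Vec using (Vec; lookup)
open import Data.Vec.Membership.Propositional using (_∈_; _∉_)
open import Data.Product using (Σ; ∃; ∃-syntax; _×_; _,_)
open import Data.Sum using (_⊎_)
open import Relation.Nullary using (¬_)
open import Relation.Binary.PropositionalEquality using (_≡_; _≢_)

-- A Coxeter matrix of rank n; the entry 0 encodes m(s,t) = ∞.
IsCoxeterMatrix : {n : ℕ} → (Fin n → Fin n → ℕ) → Set
IsCoxeterMatrix {n} M =
  (∀ s → M s s ≡ 1) ×
  (∀ s t → M s t ≡ M t s) ×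
  (∀ s t → s ≢ t → (M s t ≡ 0) ⊎ (2 ℕ.≤ M s t))

_iff_ : Set → Set → Set
P iff Q = (P → Q) × (Q → P)

Xor : Set → Set → Set
Xor P Q = (P × ¬ Q) ⊎ (¬ P × Q)

Increasing : {N k : ℕ} → Vec (Fin N) k → Set
Increasing {N} {k} x = ∀ (i j : Fin k) → i Fin.< j → lookup x i Fin.< lookup x j

Gale : {N k : ℕ} → Vec (Fin N) k → Vec (Fin N) k → Set
Gale {N} {k} x y = ∀ (i : Fin k) → lookup x i Fin.≤ lookup y i

IsSymDiff : {N k : ℕ} → Vec (Fin N) k → Vec (Fin N) k → Fin N → Fin N → Set
IsSymDiff {N} X Y a b = ∀ (x : Fin N) → (x ∈ X) iff Xor (x ∈ Y) ((x ≡ a) ⊎ (x ≡ b))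

IsShellingOrder : {N k h : ℕ} → (Fin h → Vec (Fin N) k) → Set
IsShellingOrder {N} {k} {h} C =
  ∀ (i j : Fin h) → i Fin.< j →
    Σ (Fin h) λ r → (r Fin.< j) × Σ (Fin N) λ a → Σ (Fin N) λ b →
      IsSymDiff (C r) (C j) a b × (a ∈ C j) × (a ∉ C i) × (b ∈ C r) × (b ∉ C j)

-- The Coxeter group W given by generators S = Fin n and the Coxeter presentation
-- with matrix M.  Elements of W are represented by words; equality in W is _~_.
module Coxeter {n : ℕ} (M : Fin n → Fin n → ℕ) where

  Word : Set
  Word = List (Fin n)

  braid : ℕ → Fin n → Fin n → Word
  braid m s t = concat (replicate m (s ∷ t ∷ []))

  data _~_ : Word → Word → Set where
    rel    : ∀ (a b : Word) (s t : Fin n) → M s t ≢ 0 → (a ++ braid (M s t) s t ++ b) ~ (a ++ b)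
    ~refl  : ∀ {x} → x ~ x
    ~sym   : ∀ {x y} → x ~ y → y ~ x
    ~trans : ∀ {x y z} → x ~ y → y ~ z → x ~ z

  -- inverse in W (generators are involutions)
  inv : Word → Word
  inv = reverse

  HasLength : Word → ℕ → Set
  HasLength w k = (∃[ x ] ((x ~ w) × (length x ≡ k))) × (∀ x → x ~ w → k ℕ.≤ length x)

  _≤R_ : Word → Word → Set
  u ≤R v = ∃[ a ] ∃[ b ] (HasLength u a × HasLength (inv u ++ v) b × HasLength v (a + b))

  InInterval : Word → Word → Word → Set
  InInterval u v w = (u ≤R w) × (w ≤R v)

  InParabolic : (Fin n → Set) → Word → Set
  InParabolic J x = ∃[ y ] ((y ~ x) × All J y)

  InMinCoset : (Fin n → Set) → Word → Set
  InMinCoset J x = ∀ (t : Fin n) → J t → ∀ a b → HasLength x a → HasLength (x ++ [ t ]) b → a ℕ.< b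

  -- y = x^J  (x = x^J x_J with x^J ∈ W^J, x_J ∈ W_J, lengths adding)
  IsParabolicPart : (Fin n → Set) → Word → Word → Set
  IsParabolicPart J x y =
    InMinCoset J y × InParabolic J (inv y ++ x) ×
    (∃[ a ] ∃[ b ] ∃[ c ] (HasLength x a × HasLength y b × HasLength (inv y ++ x) c × (a ≡ b + c)))

  IsP : Fin n → Word → Word → Set
  IsP s x y = IsParabolicPart (λ t → t ≢ s) x y

  IsVertex : Word → Word → Word → Fin n → Set
  IsVertex u v y s = ∃[ w ] (InInterval u v w × IsP s w y)

  -- T ∈ [N]^n_< is the image under σ of the facet P(w) = {(P^{(s)}(w), s) : s ∈ S}
  FacetImage : {N : ℕ} → (Word → Fin n → Fin N) → Word → Vec (Fin N) n → Set
  FacetImage {N} σ w T = ∀ (x : Fin N) → (x ∈ T) iff (∃[ s ] ∃[ y ] (IsP s w y × (σ y s ≡ x)))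

  LinearlyShellable : Word → Word → Set
  LinearlyShellable u v =
    Σ ℕ λ N → Σ (Word → Fin n → Fin N) λ σ →
      (∀ y y' s → IsVertex u v y s → y ~ y' → σ y s ≡ σ y' s) ×
      (∀ y s y' s' → IsVertex u v y s → IsVertex u v y' s' → σ y s ≡ σ y' s' → (y ~ y') × (s ≡ s')) ×
      (∀ (k : Fin N) → ∃[ y ] ∃[ s ] (IsVertex u v y s × (σ y s ≡ k))) ×
      Σ ℕ λ h → Σ (Fin h → Vec (Fin N) n) λ C →
        (∀ i → Increasing (C i)) ×
        (∀ i j → C i ≡ C j → i ≡ j) ×
        (∀ i → ∃[ w ] (InInterval u v w × FacetImage σ w (C i))) ×
        (∀ w T → InInterval u v w → Increasing T → FacetImage σ w T → ∃[ i ] (C i ≡ T)) ×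
        (∀ i j → Gale (C i) (C j) → i Fin.≤ j) ×
        IsShellingOrder C

{-# OPTIONS --safe #-}
module Submission where

open import Defs
open import Data.Nat using (ℕ; zero; suc; _+_; _*_; _∸_; _≤_; _<_; z≤n; s≤s)
import Data.Nat.Properties as ℕₚ
open import Data.Nat.DivMod using (_/_; _%_; m≡m%n+[m/n]*n; m%n<n; [m+kn]%n≡m%n; m<n⇒m%n≡m; +-distrib-/-∣ʳ; m*n/n≡m; m<n⇒m/n≡0)
open import Data.Nat.Divisibility using (n∣m*n)
open import Data.Nat.ListAction using (sum)
open import Data.Nat.ListAction.Properties using (sum-↭)
open import Data.Integer as ℤ using (ℤ; -[1+_]; 0ℤ; 1ℤ) renaming (+_ to pos; _+_ to _+ᶻ_; _*_ to _*ᶻ_; -_ to -ᶻ_; _-_ to _-ᶻ_; _<_ to _<ᶻ_; _≤_ to _≤ᶻ_)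
import Data.Integer.Properties as ℤₚ
open import Data.Integer.Tactic.RingSolver using (solve-∀)
open import Data.Fin as Fin using (Fin)
import Data.Fin.Properties as Finₚ
open import Data.List using (List; []; _∷_; _++_; length; [_]; deduplicate; filter; cartesianProductWith; tabulate; allFin; lookup; map)
import Data.List.Properties as Listₚ
import Data.List.Membership.Propositional as List
import Data.List.Membership.Propositional.Properties as Listₘ
open import Data.List.Relation.Unary.All as All using (All; []; _∷_)
import Data.List.Relation.Unary.All.Properties as Allₚ
open import Data.List.Relation.Unary.AllPairs as AllPairs using (AllPairs; []; _∷_)
open import Data.List.Relation.Unary.Any as Any using (Any; here; there)
import Data.List.Relation.Unary.Any.Properties as Anyₚ
open import Data.List.Relation.Unary.Linked.Properties using (Linked⇒AllPairs)
open import Data.List.Relation.Unary.Unique.DecSetoid.Properties using (deduplicate-!)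
import Data.List.Relation.Unary.Unique.Propositional.Properties as Uniqueₚ
open import Data.List.Relation.Binary.Permutation.Propositional using (_↭_; ↭-sym; ↭⇒↭ₛ)
open import Data.List.Relation.Binary.Permutation.Propositional.Properties using (All-resp-↭; Any-resp-↭; ∈-resp-↭; ↭-length; ↭-reverse; map⁺)
import Data.List.Relation.Binary.Permutation.Setoid.Properties as Permutationₛ
open import Data.List.Sort using (sort; sort-↭; sort-↗)
open import Data.Vec as Vec using (Vec; []; _∷_; fromList)
open import Data.Vec.Membership.Propositional using (_∈_; _∉_)
open import Data.Vec.Membership.Propositional.Properties using (∈-lookup; ∈-fromList⁺; ∈-fromList⁻)
import Data.Vec.Relation.Unary.Any as VecAny
import Data.Vec.Relation.Unary.Any.Properties as VecAnyₚ
open import Data.Product using (Σ; ∃-syntax; _×_; _,_; proj₁; proj₂)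
open import Data.Product.Relation.Binary.Pointwise.NonDependent using (×-isDecEquivalence)
open import Data.Sum as Sum using (_⊎_; inj₁; inj₂)
open import Data.Unit using (⊤; tt)
open import Function using (_∘_)
open import Relation.Nullary using (¬_; Dec; yes; no; contradiction)
open import Relation.Nullary.Decidable using (¬?; _×-dec_; decidable-stable)
open import Relation.Binary using (IsDecEquivalence; DecTotalOrder; tri<; tri≈; tri>)
import Relation.Binary.Construct.On as On
open import Relation.Binary.PropositionalEquality hiding ([_])
open import Relation.Binary.PropositionalEquality.Properties using (isDecEquivalence)
import Algebra.Properties.AbelianGroup
import Algebra.Properties.CommutativeSemigroup

-- W acts on the functions S → (ℕ → ℤ) through a numbers game in which the irrational
-- weight 2 cos (π / m) is replaced by a nonnegative integer operator with the same dihedral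
-- combinatorics: adjacency on paths with m - 1 vertices. Playing two generators alternately is
-- then a discrete wave equation on a strip of width m, which gives both the braid relations
-- and the positivity of the first m moves. Hence, for every word x and generator s, either
-- all values of x·h at s are positive for every positive h, or all are negative and x ~ s z
-- with z shorter; this decides the word problem and yields length, exchange and coset theory.
--
-- If ℓ(ws) > ℓ(w), the facet of ws differs from that of w only in the vertex of type s, and
-- by exchange ℓ(P^(s)(ws)) > ℓ(P^(s)(w)). Therefore, when vertices are labelled by
-- nondecreasing length, the sum of the labels of a facet is strictly monotone both for the
-- Gale order and for the weak order. Facets sorted by this sum are shelled: if w_j ≰ w_i, some
-- descent s of u⁻¹w_j satisfies P^(s)(w_j) ≠ P^(s)(w_i), for otherwise w_i would lie in
-- w_j times the parabolic subgroup of the ascents of u⁻¹w_j, above w_j; remove that vertex.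

-- Identities for integer sequences

private
  module ℤ-+ = Algebra.Properties.AbelianGroup ℤₚ.+-0-abelianGroup
  module ℕ-+ = Algebra.Properties.CommutativeSemigroup ℕₚ.+-commutativeSemigroup

cancel-sum : ∀ (a b c d e f : ℤ) → a +ᶻ b ≡ c +ᶻ d → d +ᶻ e ≡ b +ᶻ f → a +ᶻ e ≡ c +ᶻ f
cancel-sum a b c d e f p q = ℤ-+.∙-cancelʳ (b +ᶻ d) _ _ (begin
  (a +ᶻ e) +ᶻ (b +ᶻ d)  ≡⟨ r₁ a b d e ⟩
  (a +ᶻ b) +ᶻ (d +ᶻ e)  ≡⟨ cong₂ _+ᶻ_ p q ⟩
  (c +ᶻ d) +ᶻ (b +ᶻ f)  ≡⟨ r₂ b c d f ⟩
  (c +ᶻ f) +ᶻ (b +ᶻ d)  ∎)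
  where
  open ≡-Reasoning
  r₁ : ∀ a b d e → (a +ᶻ e) +ᶻ (b +ᶻ d) ≡ (a +ᶻ b) +ᶻ (d +ᶻ e)
  r₁ = solve-∀
  r₂ : ∀ b c d f → (c +ᶻ d) +ᶻ (b +ᶻ f) ≡ (c +ᶻ f) +ᶻ (b +ᶻ d)
  r₂ = solve-∀

0<-+ : ∀ {a b} → 0ℤ <ᶻ a → 0ℤ ≤ᶻ b → 0ℤ <ᶻ a +ᶻ b
0<-+ p q = ℤₚ.+-mono-<-≤ p q

0<-neg : ∀ {a} → a <ᶻ 0ℤ → 0ℤ <ᶻ -ᶻ a
0<-neg p = ℤₚ.neg-mono-< p

+-moveˡ : ∀ a {b} c → a +ᶻ b ≡ c → b ≡ -ᶻ a +ᶻ c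
+-moveˡ a {b} c e = trans (sym (ℤ-+.\\-leftDividesʳ a b)) (cong ((-ᶻ a) +ᶻ_) e)

-- The recurrence makes `z j` equal to `j` times `z 1`, and the zero at `suc d` then forces `z 1` to
-- vanish.
arithmetic-progression-zero : (z : ℕ → ℤ) (d : ℕ) → z 0 ≡ 0ℤ → z (suc d) ≡ 0ℤ →
  (∀ j → suc j < suc d → z (suc j) +ᶻ z (suc j) ≡ z (suc (suc j)) +ᶻ z j) →
  ∀ j → j ≤ suc d → z j ≡ 0ℤ
arithmetic-progression-zero z d z0 zd rec j j≤ = trans (multiple j j≤) (trans (cong ((pos j) *ᶻ_) z1) (ℤₚ.*-zeroʳ (pos j)))
  where
  open ≡-Reasoning
  multiple : ∀ j → j ≤ suc d → z j ≡ (pos j) *ᶻ z 1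
  multiple 0 _ = trans z0 (sym (ℤₚ.*-zeroˡ (z 1)))
  multiple 1 _ = sym (ℤₚ.*-identityˡ (z 1))
  multiple (suc (suc j)) p = begin
    z (suc (suc j))                                      ≡⟨ s (z (suc (suc j))) (z j) ⟩
    (z (suc (suc j)) +ᶻ z j) -ᶻ z j                     ≡⟨ cong (_-ᶻ z j) (sym (rec j p)) ⟩
    (z (suc j) +ᶻ z (suc j)) -ᶻ z j                     ≡⟨ cong₂ (λ a b → (a +ᶻ a) -ᶻ b) (multiple (suc j) (ℕₚ.<⇒≤ p)) (multiple j (ℕₚ.<⇒≤ (ℕₚ.<⇒≤ p))) ⟩
    ((1ℤ +ᶻ pos j) *ᶻ z 1 +ᶻ (1ℤ +ᶻ pos j) *ᶻ z 1) -ᶻ (pos j) *ᶻ z 1   ≡⟨ t (pos j) (z 1) ⟩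
    (1ℤ +ᶻ (1ℤ +ᶻ pos j)) *ᶻ z 1 ∎
    where
    s : ∀ a b → a ≡ (a +ᶻ b) -ᶻ b
    s = solve-∀
    t : ∀ k a → ((1ℤ +ᶻ k) *ᶻ a +ᶻ (1ℤ +ᶻ k) *ᶻ a) -ᶻ k *ᶻ a ≡ (1ℤ +ᶻ (1ℤ +ᶻ k)) *ᶻ a
    t = solve-∀
  z1 : z 1 ≡ 0ℤ
  z1 with ℤₚ.i*j≡0⇒i≡0∨j≡0 (pos (suc d)) (trans (sym (multiple (suc d) ℕₚ.≤-refl)) zd)
  ... | inj₂ e = e

-- When two vertices are fired in turn, one of them fires at the times of one parity. These sums
-- record what it has sent to a third vertex.
alternate-sum : (ℕ → ℤ) → ℕ → ℕ → ℤ
alternate-sum f zero    k = 0ℤ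
alternate-sum f (suc l) k = f k +ᶻ alternate-sum f l (2 + k)

alternate-sum-shift : ∀ f l k → alternate-sum f (suc l) k ≡ alternate-sum f l k +ᶻ f (l + (l + k))
alternate-sum-shift f zero k = ℤₚ.+-comm (f k) 0ℤ
alternate-sum-shift f (suc l) k = trans (cong (f k +ᶻ_) (alternate-sum-shift f l (2 + k)))
  (trans (sym (ℤₚ.+-assoc (f k) _ _)) (cong (λ e → alternate-sum f (suc l) k +ᶻ f e)
    (trans (cong (l +_) (ℕₚ.+-suc l (suc k)))
      (trans (ℕₚ.+-suc l (l + suc k)) (cong suc (cong (l +_) (ℕₚ.+-suc l k)))))))

-- The discrete wave equation on a strip

-- Solutions of the discrete wave equation on a strip of width m with Dirichlet
-- boundary conditions; the time k is the first argument, the position the second.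
module Wave (m : ℕ) (v : ℕ → ℕ → ℤ)
  (left : ∀ k → v k 0 ≡ 0ℤ) (right : ∀ k → v k m ≡ 0ℤ)
  (wave : ∀ k j → suc (suc j) ≤ m →
    v k (suc j) +ᶻ v (suc (suc k)) (suc j) ≡ v (suc k) (suc (suc j)) +ᶻ v (suc k) j) where

  -- The parallelogram law of the wave equation: over a rectangle with sides along the
  -- characteristics, opposite corners have equal sums. Unit cells are laid in a row and the shared
  -- corners cancel; `rectangle` then stacks such rows.
  thin-rectangle : ∀ q k i → suc q + i ≤ m →
    v k (q + i) +ᶻ v (suc q + k) (suc i) ≡ v (suc k) (suc q + i) +ᶻ v (q + k) i
  thin-rectangle zero k i p = ℤₚ.+-comm (v k i) (v (suc k) (suc i))
  thin-rectangle (suc q) k i p =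
    cancel-sum (v k (suc q + i)) (v (suc q + k) (suc (suc i))) (v (suc k) (suc (suc q) + i)) (v (q + k) (suc i))
      (v (suc (suc q) + k) (suc i)) (v (suc q + k) i)
      (subst (λ e → v k e +ᶻ v (suc q + k) (suc (suc i)) ≡ v (suc k) (suc e) +ᶻ v (q + k) (suc i))
        (ℕₚ.+-suc q i) (thin-rectangle q k (suc i) (subst (_≤ m) (cong suc (sym (ℕₚ.+-suc q i))) p)))
      (wave (q + k) i (ℕₚ.≤-trans (s≤s (s≤s (ℕₚ.m≤n+m i q))) p))

  rectangle : ∀ p q k i → p + (q + i) ≤ m →
    v k (q + i) +ᶻ v (p + (q + k)) (p + i) ≡ v (p + k) (p + (q + i)) +ᶻ v (q + k) i
  rectangle zero q k i _ = refl
  rectangle (suc p) q k i le =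
    trans (cancel-sum (v k (q + i)) (v (p + (q + k)) (p + i)) (v (q + k) i) (v (p + k) (p + (q + i)))
        (v (suc p + (q + k)) (suc p + i)) (v (suc p + k) (suc p + (q + i)))
        (trans (rectangle p q k i (ℕₚ.<⇒≤ le)) (ℤₚ.+-comm (v (p + k) (p + (q + i))) _))
        (trans (subst₂ (λ e f → v (p + k) f +ᶻ v (suc e) (suc (p + i)) ≡ v (suc (p + k)) (suc f) +ᶻ v e (p + i))
            (ℕ-+.x∙yz≈y∙xz q p k) (ℕ-+.x∙yz≈y∙xz q p i)
            (thin-rectangle q (p + k) (p + i) (subst (λ e → suc e ≤ m) (ℕ-+.x∙yz≈y∙xz p q i) le)))
          (ℤₚ.+-comm (v (suc (p + k)) _) _)))
      (ℤₚ.+-comm (v (q + k) i) _)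

  -- The rectangle is chosen with one corner on each wall. Those two corners vanish, so after time
  -- `m` the wave returns as its mirror image with opposite sign.
  half-turn : ∀ k i j → j + i ≡ m → v (m + k) j ≡ -ᶻ v k i
  half-turn k i j refl = ℤ-+.inverseʳ-unique (v k i) (v (j + i + k) j)
    (trans (subst₂ (λ e f → v k e +ᶻ v f j ≡ v (j + k) (j + e) +ᶻ v (i + k) 0)
        (ℕₚ.+-identityʳ i) (sym (ℕₚ.+-assoc j i k))
        (subst (λ f → v k (i + 0) +ᶻ v (j + (i + k)) f ≡ v (j + k) (j + (i + 0)) +ᶻ v (i + k) 0)
          (ℕₚ.+-identityʳ j) (rectangle j i k 0 (ℕₚ.≤-reflexive (cong (j +_) (ℕₚ.+-identityʳ i))))))
      (cong₂ _+ᶻ_ (right (j + k)) (left (i + k))))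

  periodic : ∀ k j → j ≤ m → v (m + (m + k)) j ≡ v k j
  periodic k j j≤m = trans (half-turn (m + k) (m ∸ j) j (ℕₚ.m+[n∸m]≡n j≤m))
    (trans (cong -ᶻ_ (half-turn k j (m ∸ j) (ℕₚ.m∸n+n≡m j≤m))) (ℤₚ.neg-involutive (v k j)))

  sum-at : ℕ → ℕ → ℕ → ℤ
  sum-at l k j = alternate-sum (λ t → v t j) l k

  -- The `m` terms span a whole period `2m`, so the term appended by the shift equals the one
  -- dropped.
  alternate-sum-periodic : ∀ k j → j ≤ m → sum-at m (2 + k) j ≡ sum-at m k j
  alternate-sum-periodic k j p = ℤ-+.∙-cancelˡ (v k j) _ _
    (trans (alternate-sum-shift (λ t → v t j) m k)
      (trans (cong (sum-at m k j +ᶻ_) (periodic k j p)) (ℤₚ.+-comm _ (v k j))))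

  alternate-sum-wave : ∀ l k j → suc (suc j) ≤ m →
    sum-at l k (suc j) +ᶻ sum-at l (suc (suc k)) (suc j)
      ≡ sum-at l (suc k) (suc (suc j)) +ᶻ sum-at l (suc k) j
  alternate-sum-wave zero k j p = refl
  alternate-sum-wave (suc l) k j p =
    trans (interchange (v k (suc j)) _ _ _)
      (trans (cong₂ _+ᶻ_ (wave k j p) (alternate-sum-wave l (2 + k) j p))
        (sym (interchange (v (suc k) (suc (suc j))) _ _ _)))
    where
    interchange : ∀ a b c d → (a +ᶻ b) +ᶻ (c +ᶻ d) ≡ (a +ᶻ c) +ᶻ (b +ᶻ d)
    interchange = solve-∀

  alternate-sum-zero : ∀ d → m ≡ suc d → ∀ k j → j ≤ m → sum-at m k j ≡ 0ℤ
  alternate-sum-zero d m≡ k j j≤m = trans (sym (shift j))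
      (arithmetic-progression-zero diagonal d (sum-left m) (subst (λ e → diagonal e ≡ 0ℤ) m≡ (sum-right m)) step j
        (subst (j ≤_) m≡ j≤m))
    where
    -- The sums are 2-periodic in time, hence along the diagonal the wave equation
    -- becomes the equation of an arithmetic progression.
    diagonal : ℕ → ℤ
    diagonal i = sum-at m (i + (j + k)) i
    sum-left : ∀ l {k} → sum-at l k 0 ≡ 0ℤ
    sum-left zero = refl
    sum-left (suc l) {k} = cong₂ _+ᶻ_ (left k) (sum-left l)
    sum-right : ∀ l {k} → sum-at l k m ≡ 0ℤ
    sum-right zero = refl
    sum-right (suc l) {k} = cong₂ _+ᶻ_ (right k) (sum-right l)
    -- The diagonal passes position `j` at time `k + 2j`, an even shift of `k`, which the sums do
    -- not notice.
    shift : ∀ i → sum-at m (i + (i + k)) j ≡ sum-at m k j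
    shift zero = refl
    shift (suc i) = trans (cong (λ e → sum-at m (suc e) j) (ℕₚ.+-suc i (i + k)))
      (trans (alternate-sum-periodic (i + (i + k)) j j≤m) (shift i))
    step : ∀ i → suc i < suc d → diagonal (suc i) +ᶻ diagonal (suc i) ≡ diagonal (suc (suc i)) +ᶻ diagonal i
    step i p = trans (cong₂ _+ᶻ_ (sym (alternate-sum-periodic (suc i + (j + k)) (suc i) (ℕₚ.<⇒≤ le))) refl)
      (trans (ℤₚ.+-comm (sum-at m (suc (suc (suc i + (j + k)))) (suc i)) _)
      (trans (alternate-sum-wave m (suc i + (j + k)) i le)
        (cong (sum-at m (suc (suc i + (j + k))) (suc (suc i)) +ᶻ_) (alternate-sum-periodic (i + (j + k)) i (ℕₚ.<⇒≤ (ℕₚ.<⇒≤ le))))))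
      where
      le : suc (suc i) ≤ m
      le = subst (suc (suc i) ≤_) (sym m≡) p

  module Positivity
    (initial₀ : ∀ j → 0 < j → j < m → v 0 j <ᶻ 0ℤ)
    (initial₁ : ∀ j → 0 < j → j < m → 0ℤ <ᶻ v 1 j) where

    initial₁-≥0 : ∀ j → j ≤ m → 0ℤ ≤ᶻ v 1 j
    initial₁-≥0 zero _ = ℤₚ.≤-reflexive (sym (left 1))
    initial₁-≥0 (suc j) p with ℕₚ.m≤n⇒m<n∨m≡n p
    ... | inj₁ q    = ℤₚ.<⇒≤ (initial₁ (suc j) (s≤s z≤n) q)
    ... | inj₂ refl = ℤₚ.≤-reflexive (sym (right 1))

    -- Before any reflection at the right wall, a thin rectangle reaches back to time 0. It writes
    -- the value as minus a negative value at time 0 plus a nonnegative value at time 1 plus a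
    -- nonnegative earlier value.
    below : ∀ q i → q + i < m → suc i < m → 0ℤ <ᶻ v (suc q) (suc i)
    nonneg : ∀ q i → suc q + i ≤ m → 0ℤ ≤ᶻ v (suc q) i

    below zero i p r = initial₁ (suc i) (s≤s z≤n) r
    below (suc q) i p r = subst (0ℤ <ᶻ_) (sym value)
        (0<-+ (0<-neg (initial₀ (suc q + i) (s≤s z≤n) p))
          (ℤₚ.+-mono-≤ (initial₁-≥0 (suc (suc q) + i) p) (nonneg q i (ℕₚ.<⇒≤ p))))
      where
      value : v (suc (suc q)) (suc i) ≡ -ᶻ v 0 (suc q + i) +ᶻ (v 1 (suc (suc q) + i) +ᶻ v (suc q) i)
      value = +-moveˡ (v 0 (suc q + i)) _
        (subst (λ e → v 0 (suc q + i) +ᶻ v (suc (suc e)) (suc i) ≡ v 1 (suc (suc q) + i) +ᶻ v (suc e) i)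
          (ℕₚ.+-identityʳ q) (thin-rectangle (suc q) 0 i p))

    nonneg q zero _ = ℤₚ.≤-reflexive (sym (left (suc q)))
    nonneg q (suc i) p = ℤₚ.<⇒≤ (below q i
      (ℕₚ.≤-trans (s≤s (ℕₚ.+-monoʳ-≤ q (ℕₚ.n≤1+n i))) p)
      (ℕₚ.≤-trans (s≤s (ℕₚ.m≤n+m (suc i) q)) p))

    -- After reflection the rectangle has a corner on the right wall instead, where the value is
    -- zero; the corner at time 0 again makes the result strictly positive.
    above : ∀ p q i → suc p + (suc q + i) ≡ m → 0ℤ <ᶻ v (suc p + suc q) (suc p + i)
    above p q i refl = subst (0ℤ <ᶻ_) (sym value)
        (0<-+ (0<-neg (initial₀ (suc q + i) (s≤s z≤n) (s≤s (ℕₚ.m≤n+m (suc q + i) p))))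
          (ℤₚ.+-mono-≤ (ℤₚ.≤-reflexive (sym (right (suc p + 0)))) (nonneg q i (ℕₚ.m≤n+m (suc q + i) (suc p)))))
      where
      value : v (suc p + suc q) (suc p + i) ≡ -ᶻ v 0 (suc q + i) +ᶻ (v (suc p + 0) (suc p + (suc q + i)) +ᶻ v (suc q) i)
      value = +-moveˡ (v 0 (suc q + i)) _
        (subst (λ e → v 0 (suc q + i) +ᶻ v (suc p + e) (suc p + i) ≡ v (suc p + 0) (suc p + (suc q + i)) +ᶻ v e i)
          (ℕₚ.+-identityʳ (suc q)) (rectangle (suc p) (suc q) 0 i ℕₚ.≤-refl))

    positive : ∀ k j → suc k ≤ m → suc j < m → 0ℤ <ᶻ v (suc k) (suc j)
    positive k j k<m j<m with suc (k + j) ℕₚ.≤? m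
    ... | yes p = below k j p j<m
    ... | no ¬p = subst₂ (λ a b → 0ℤ <ᶻ v a b) pq pi (above p q i total)
      where
      -- These solve `p + q + 2 = k + 1`, `p + i = j` and `p + q + i + 2 = m`; the last equation
      -- puts a corner of the rectangle on the right wall.
      q i p : ℕ
      q = m ∸ suc (suc j)
      i = m ∸ suc k
      p = k ∸ suc q
      qj : suc q + suc j ≡ m
      qj = trans (sym (ℕₚ.+-suc q (suc j))) (ℕₚ.m∸n+n≡m j<m)
      q<k : suc q ≤ k
      q<k = ℕₚ.+-cancelʳ-≤ j (suc q) k (ℕₚ.≤-pred (subst (_≤ suc (k + j)) (trans (sym qj) (ℕₚ.+-suc (suc q) j)) (ℕₚ.≰⇒≥ ¬p)))
      pq : suc p + suc q ≡ suc k
      pq = cong suc (ℕₚ.m∸n+n≡m q<k)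
      total : suc p + (suc q + i) ≡ m
      total = trans (sym (ℕₚ.+-assoc (suc p) (suc q) i)) (trans (cong (_+ i) pq) (ℕₚ.m+[n∸m]≡n k<m))
      pi : suc p + i ≡ suc j
      pi = ℕₚ.+-cancelˡ-≡ (suc q) (suc p + i) (suc j)
        (trans (ℕ-+.x∙yz≈y∙xz (suc q) (suc p) i) (trans total (sym qj)))

-- Path adjacency operators as edge weights

-- The indices are cut into blocks of length `d`, one for each path. Block `q` occupies positions 1
-- to `d`, and the zeros around it are the walls of the strip.
row : ℕ → ℕ → (ℕ → ℤ) → ℕ → ℤ
row d q g zero    = 0ℤ
row d q g (suc j) with j ℕₚ.<? d
... | yes _ = g (q * d + j)
... | no _  = 0ℤ

row-inside : ∀ d q g {j} → j < d → row d q g (suc j) ≡ g (q * d + j)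
row-inside d q g {j} j<d with j ℕₚ.<? d
... | yes _ = refl
... | no ¬p = contradiction j<d ¬p

row-end : ∀ d q g → row d q g (suc d) ≡ 0ℤ
row-end d q g with d ℕₚ.<? d
... | yes p = contradiction p (ℕₚ.<-irrefl refl)
... | no _  = refl

row-linear : ∀ d q g c k j → row d q (λ i → g i +ᶻ c *ᶻ k i) j ≡ row d q g j +ᶻ c *ᶻ row d q k j
row-linear d q g c k zero = sym (trans (ℤₚ.+-identityˡ _) (ℤₚ.*-zeroʳ c))
row-linear d q g c k (suc j) with j ℕₚ.<? d
... | yes _ = refl
... | no _  = sym (trans (ℤₚ.+-identityˡ _) (ℤₚ.*-zeroʳ c))

row-cong : ∀ d q {g k} → g ≗ k → row d q g ≗ row d q k
row-cong d q e zero = refl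
row-cong d q e (suc j) with j ℕₚ.<? d
... | yes _ = e (q * d + j)
... | no _  = refl

row-≥0 : ∀ d q {g} → (∀ i → 0ℤ ≤ᶻ g i) → ∀ j → 0ℤ ≤ᶻ row d q g j
row-≥0 d q p zero = ℤₚ.≤-refl
row-≥0 d q p (suc j) with j ℕₚ.<? d
... | yes _ = p (q * d + j)
... | no _  = ℤₚ.≤-refl

-- The weight 2 cos (π / m) of a Coxeter graph edge is replaced by the adjacency
-- operator of a disjoint union of paths with m - 1 vertices each, and 2 cos 0 by 2.
edge : ℕ → (ℕ → ℤ) → ℕ → ℤ
edge 0 g i = g i +ᶻ g i
edge 1 g i = 0ℤ
edge (suc (suc d)) g i =
  row (suc d) (i / suc d) g (i % suc d) +ᶻ row (suc d) (i / suc d) g (suc (suc (i % suc d)))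

-- The one form `g + c k` yields negation, sums and zero below, with `c` equal to -2, 1 and -1.
-- General `c` serves later, when a state is perturbed by a multiple of another.
edge-linear : ∀ m g c k i → edge m (λ i → g i +ᶻ c *ᶻ k i) i ≡ edge m g i +ᶻ c *ᶻ edge m k i
edge-linear 0 g c k i = s (g i) c (k i)
  where
  s : ∀ a c b → (a +ᶻ c *ᶻ b) +ᶻ (a +ᶻ c *ᶻ b) ≡ (a +ᶻ a) +ᶻ c *ᶻ (b +ᶻ b)
  s = solve-∀
edge-linear 1 g c k i = sym (trans (ℤₚ.+-identityˡ _) (ℤₚ.*-zeroʳ c))
edge-linear (suc (suc d)) g c k i =
  trans (cong₂ _+ᶻ_ (row-linear (suc d) (i / suc d) g c k (i % suc d)) (row-linear (suc d) (i / suc d) g c k (suc (suc (i % suc d)))))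
    (s (row (suc d) (i / suc d) g (i % suc d)) _ c (row (suc d) (i / suc d) k (i % suc d)) _)
  where
  s : ∀ a a' c b b' → (a +ᶻ c *ᶻ b) +ᶻ (a' +ᶻ c *ᶻ b') ≡ (a +ᶻ a') +ᶻ c *ᶻ (b +ᶻ b')
  s = solve-∀

edge-cong : ∀ m {g k} → g ≗ k → edge m g ≗ edge m k
edge-cong 0 e i = cong₂ _+ᶻ_ (e i) (e i)
edge-cong 1 e i = refl
edge-cong (suc (suc d)) e i = cong₂ _+ᶻ_ (row-cong (suc d) (i / suc d) e (i % suc d)) (row-cong (suc d) (i / suc d) e (suc (suc (i % suc d))))

edge-≥0 : ∀ m {g} → (∀ i → 0ℤ ≤ᶻ g i) → ∀ i → 0ℤ ≤ᶻ edge m g i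
edge-≥0 0 p i = ℤₚ.+-mono-≤ (p i) (p i)
edge-≥0 1 p i = ℤₚ.≤-refl
edge-≥0 (suc (suc d)) p i = ℤₚ.+-mono-≤ (row-≥0 (suc d) (i / suc d) p (i % suc d)) (row-≥0 (suc d) (i / suc d) p (suc (suc (i % suc d))))

edge-neg : ∀ m g i → edge m (λ i → -ᶻ g i) i ≡ -ᶻ edge m g i
edge-neg m g i = trans (edge-cong m (λ i → s (g i)) i) (trans (edge-linear m g (-[1+ 1 ]) g i) (sym (s (edge m g i))))
  where
  s : ∀ a → -ᶻ a ≡ a +ᶻ -[1+ 1 ] *ᶻ a
  s = solve-∀

edge-+ : ∀ m g k i → edge m (λ i → g i +ᶻ k i) i ≡ edge m g i +ᶻ edge m k i
edge-+ m g k i = trans (edge-cong m (λ i → s (g i) (k i)) i) (trans (edge-linear m g 1ℤ k i) (sym (s (edge m g i) _)))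
  where
  s : ∀ a b → a +ᶻ b ≡ a +ᶻ 1ℤ *ᶻ b
  s = solve-∀

edge-0 : ∀ m {g} → (∀ i → g i ≡ 0ℤ) → ∀ i → edge m g i ≡ 0ℤ
edge-0 m {g} z i = trans (edge-cong m (λ i → trans (z i) (sym (cong₂ (λ a b → a +ᶻ -[1+ 0 ] *ᶻ b) (z i) (z i)))) i)
  (trans (edge-linear m g -[1+ 0 ] g i) (s (edge m g i)))
  where
  s : ∀ a → a +ᶻ -[1+ 0 ] *ᶻ a ≡ 0ℤ
  s = solve-∀

-- Two generators fired in turn

-- When two generators s and t are played alternately in the numbers game, these are
-- the values successively fired, α being the initial value at the vertex fired second.
fired : ℕ → (α β : ℕ → ℤ) → ℕ → ℕ → ℤ
fired m α β 0 i = -ᶻ α i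
fired m α β 1 i = β i
fired m α β (suc (suc k)) i = edge m (fired m α β (suc k)) i -ᶻ fired m α β k i

Positive Negative NonNegative : (ℕ → ℤ) → Set
Positive a    = ∀ i → 0ℤ <ᶻ a i
Negative a    = ∀ i → a i <ᶻ 0ℤ
NonNegative a = ∀ i → 0ℤ ≤ᶻ a i

div-block : ∀ q d {j} → j < suc d → (q * suc d + j) / suc d ≡ q
div-block q d {j} j<d = trans (cong (_/ suc d) (ℕₚ.+-comm (q * suc d) j))
  (trans (+-distrib-/-∣ʳ j (n∣m*n q)) (cong₂ _+_ (m<n⇒m/n≡0 j<d) (m*n/n≡m q (suc d))))

mod-block : ∀ q d {j} → j < suc d → (q * suc d + j) % suc d ≡ j
mod-block q d {j} j<d = trans (cong (_% suc d) (ℕₚ.+-comm (q * suc d) j))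
  (trans ([m+kn]%n≡m%n j q (suc d)) (m<n⇒m%n≡m j<d))

-- On each row the recurrence defining `fired` is the wave equation solved for the latest time, so
-- the results for a strip of width `m` apply row by row.
module FiniteEdge (d : ℕ) (α β : ℕ → ℤ) where

  m : ℕ
  m = suc (suc d)

  strip : ℕ → ℕ → ℕ → ℤ
  strip q k = row (suc d) q (fired m α β k)

  strip-wave : ∀ q k j → suc (suc j) ≤ m →
    strip q k (suc j) +ᶻ strip q (suc (suc k)) (suc j) ≡ strip q (suc k) (suc (suc j)) +ᶻ strip q (suc k) j
  strip-wave q k j (s≤s j<d) = begin
    strip q k (suc j) +ᶻ strip q (suc (suc k)) (suc j)
      ≡⟨ cong₂ _+ᶻ_ (row-inside (suc d) q (fired m α β k) j<d) (row-inside (suc d) q (fired m α β (suc (suc k))) j<d) ⟩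
    fired m α β k i +ᶻ (edge m (fired m α β (suc k)) i -ᶻ fired m α β k i)
      ≡⟨ s (fired m α β k i) (row (suc d) (i / suc d) (fired m α β (suc k)) (i % suc d)) _ ⟩
    row (suc d) (i / suc d) (fired m α β (suc k)) (suc (suc (i % suc d))) +ᶻ row (suc d) (i / suc d) (fired m α β (suc k)) (i % suc d)
      ≡⟨ cong₂ (λ a b → row (suc d) a (fired m α β (suc k)) (suc (suc b)) +ᶻ row (suc d) a (fired m α β (suc k)) b) (div-block q d j<d) (mod-block q d j<d) ⟩
    strip q (suc k) (suc (suc j)) +ᶻ strip q (suc k) j ∎
    where
    open ≡-Reasoning
    i = q * suc d + j
    s : ∀ a b c → a +ᶻ ((b +ᶻ c) -ᶻ a) ≡ c +ᶻ b
    s = solve-∀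

  module _ (q : ℕ) where
    open Wave m (strip q) (λ _ → refl) (λ k → row-end (suc d) q (fired m α β k)) (strip-wave q) public

  strip-value : ∀ k i → strip (i / suc d) k (suc (i % suc d)) ≡ fired m α β k i
  strip-value k i = trans (row-inside (suc d) (i / suc d) (fired m α β k) (m%n<n i (suc d)))
    (cong (fired m α β k) (trans (ℕₚ.+-comm (i / suc d * suc d) _) (sym (m≡m%n+[m/n]*n i (suc d)))))

  inside : ∀ i → suc (i % suc d) ≤ m
  inside i = s≤s (ℕₚ.<⇒≤ (m%n<n i (suc d)))

  fired-periodic : ∀ k i → fired m α β (m + (m + k)) i ≡ fired m α β k i
  fired-periodic k i = trans (sym (strip-value (m + (m + k)) i)) (trans (periodic (i / suc d) k _ (inside i)) (strip-value k i))

  fired-sum : ∀ k i → alternate-sum (λ t → fired m α β t i) m k ≡ 0ℤ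
  fired-sum k i = trans (sym (sum-cong m k)) (alternate-sum-zero (i / suc d) (suc d) refl k _ (inside i))
    where
    sum-cong : ∀ l k → alternate-sum (λ t → strip (i / suc d) t (suc (i % suc d))) l k ≡ alternate-sum (λ t → fired m α β t i) l k
    sum-cong zero k = refl
    sum-cong (suc l) k = cong₂ _+ᶻ_ (strip-value k i) (sum-cong l (2 + k))

  fired-positive : Positive α → Positive β → ∀ k → suc k ≤ m → Positive (fired m α β (suc k))
  fired-positive pα pβ k k<m i = subst (0ℤ <ᶻ_) (strip-value (suc k) i)
    (Positivity.positive (i / suc d) initial₀ initial₁ k (i % suc d) k<m (s≤s (m%n<n i (suc d))))
    where
    initial₀ : ∀ j → 0 < j → j < m → strip (i / suc d) 0 j <ᶻ 0ℤ
    initial₀ (suc j) _ (s≤s p) = subst (_<ᶻ 0ℤ) (sym (row-inside (suc d) (i / suc d) (fired m α β 0) p)) (ℤₚ.neg-mono-< (pα _))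
    initial₁ : ∀ j → 0 < j → j < m → 0ℤ <ᶻ strip (i / suc d) 1 j
    initial₁ (suc j) _ (s≤s p) = subst (0ℤ <ᶻ_) (sym (row-inside (suc d) (i / suc d) (fired m α β 1) p)) (pβ _)

-- For infinite `m` the weight is 2, so all consecutive differences agree with the first one,
-- `β + α`.
fired-increasing : ∀ α β → Positive α → Positive β → ∀ k i → fired 0 α β k i <ᶻ fired 0 α β (suc k) i
fired-increasing α β pα pβ zero i = ℤₚ.<-trans (ℤₚ.neg-mono-< (pα i)) (pβ i)
fired-increasing α β pα pβ (suc k) i = subst (fired 0 α β (suc k) i <ᶻ_) (s (fired 0 α β (suc k) i) _)
    (subst (_<ᶻ (b +ᶻ (b -ᶻ fired 0 α β k i))) (ℤₚ.+-identityʳ b) (ℤₚ.+-monoʳ-< b 0<b-c))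
  where
  b = fired 0 α β (suc k) i
  0<b-c : 0ℤ <ᶻ b -ᶻ fired 0 α β k i
  0<b-c = subst (_<ᶻ b -ᶻ fired 0 α β k i) (ℤₚ.+-inverseʳ (fired 0 α β k i))
    (ℤₚ.+-monoˡ-< (-ᶻ fired 0 α β k i) (fired-increasing α β pα pβ k i))
  s : ∀ a c → a +ᶻ (a -ᶻ c) ≡ (a +ᶻ a) -ᶻ c
  s = solve-∀

fired-positive : ∀ m α β → m ≢ 1 → Positive α → Positive β → ∀ k → (m ≡ 0) ⊎ (suc k ≤ m) → Positive (fired m α β (suc k))
fired-positive 0 α β _ pα pβ zero _ i = pβ i
fired-positive 0 α β ne pα pβ (suc k) _ i =
  ℤₚ.<-trans (fired-positive 0 α β ne pα pβ k (inj₁ refl) i) (fired-increasing α β pα pβ (suc k) i)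
fired-positive 1 α β ne = contradiction refl ne
fired-positive (suc (suc d)) α β _ pα pβ k (inj₂ p) = FiniteEdge.fired-positive d α β pα pβ k p

-- Words as elements of the group

module CoxeterGroup {n : ℕ} (M : Fin n → Fin n → ℕ) (isCoxeter : IsCoxeterMatrix M) where
  open Coxeter M

  M-diagonal : ∀ s → M s s ≡ 1
  M-diagonal = proj₁ isCoxeter

  M-symmetric : ∀ s t → M s t ≡ M t s
  M-symmetric = proj₁ (proj₂ isCoxeter)

  M-offdiagonal : ∀ {s t} → s ≢ t → (M s t ≡ 0) ⊎ (2 ≤ M s t)
  M-offdiagonal = proj₂ (proj₂ isCoxeter) _ _

  ++-congʳ : ∀ {x y} c → x ~ y → (x ++ c) ~ (y ++ c)
  ++-congʳ c (rel a b s t ne) = subst₂ _~_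
    (sym (trans (Listₚ.++-assoc a _ c) (cong (a ++_) (Listₚ.++-assoc (braid (M s t) s t) b c))))
    (sym (Listₚ.++-assoc a b c)) (rel a (b ++ c) s t ne)
  ++-congʳ c ~refl = ~refl
  ++-congʳ c (~sym p) = ~sym (++-congʳ c p)
  ++-congʳ c (~trans p q) = ~trans (++-congʳ c p) (++-congʳ c q)

  ++-congˡ : ∀ c {x y} → x ~ y → (c ++ x) ~ (c ++ y)
  ++-congˡ c (rel a b s t ne) = subst₂ _~_ (Listₚ.++-assoc c a _) (Listₚ.++-assoc c a b) (rel (c ++ a) b s t ne)
  ++-congˡ c ~refl = ~refl
  ++-congˡ c (~sym p) = ~sym (++-congˡ c p)
  ++-congˡ c (~trans p q) = ~trans (++-congˡ c p) (++-congˡ c q)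

  ∷-cong : ∀ s {x y} → x ~ y → (s ∷ x) ~ (s ∷ y)
  ∷-cong s = ++-congˡ [ s ]

  ≡⇒~ : ∀ {x y} → x ≡ y → x ~ y
  ≡⇒~ refl = ~refl

  involution : ∀ s x → (s ∷ s ∷ x) ~ x
  involution s x = subst (λ e → (braid e s s ++ x) ~ x) (M-diagonal s)
    (rel [] x s s (λ e → contradiction (trans (sym (M-diagonal s)) e) λ ()))

  move-letter : ∀ {s x y} → (s ∷ x) ~ y → x ~ (s ∷ y)
  move-letter {s} {x} p = ~trans (~sym (involution s x)) (∷-cong s p)

  inv-∷ : ∀ s x → inv (s ∷ x) ≡ inv x ++ [ s ]
  inv-∷ s x = Listₚ.unfold-reverse s x

  inv-++ : ∀ x y → inv (x ++ y) ≡ inv y ++ inv x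
  inv-++ = Listₚ.reverse-++

  inv-inv : ∀ x → inv (inv x) ≡ x
  inv-inv = Listₚ.reverse-involutive

  inverseˡ : ∀ x → (inv x ++ x) ~ []
  inverseˡ [] = ~refl
  inverseˡ (s ∷ x) = ~trans (≡⇒~ (trans (cong (_++ s ∷ x) (inv-∷ s x)) (Listₚ.++-assoc (inv x) [ s ] (s ∷ x))))
    (~trans (++-congˡ (inv x) (involution s x)) (inverseˡ x))

  inverseʳ : ∀ x → (x ++ inv x) ~ []
  inverseʳ x = subst (λ e → (e ++ inv x) ~ []) (inv-inv x) (inverseˡ (inv x))

  cancelˡ : ∀ x y → (inv x ++ (x ++ y)) ~ y
  cancelˡ x y = ~trans (≡⇒~ (sym (Listₚ.++-assoc (inv x) x y))) (++-congʳ y (inverseˡ x))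

  cancelˡ′ : ∀ x y → (x ++ (inv x ++ y)) ~ y
  cancelˡ′ x y = ~trans (≡⇒~ (sym (Listₚ.++-assoc x (inv x) y))) (++-congʳ y (inverseʳ x))

  cancelʳ : ∀ x y → ((x ++ y) ++ inv y) ~ x
  cancelʳ x y = ~trans (≡⇒~ (Listₚ.++-assoc x y (inv y)))
    (~trans (++-congˡ x (inverseʳ y)) (≡⇒~ (Listₚ.++-identityʳ x)))

  inv-cong : ∀ {x y} → x ~ y → inv x ~ inv y
  inv-cong {x} {y} p = ~trans (~sym (cancelʳ (inv x) y))
    (~trans (++-congʳ (inv y) (++-congˡ (inv x) (~sym p))) (++-congʳ (inv y) (inverseˡ x)))

  -- The numbers game

  State : Set
  State = Fin n → ℕ → ℤ

  infix 4 _≋_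
  _≋_ : State → State → Set
  h ≋ k = ∀ r i → h r i ≡ k r i

  -- One move of Mozes' numbers game.
  fire : Fin n → State → State
  fire s h r i with r Finₚ.≟ s
  ... | yes _ = -ᶻ h s i
  ... | no _  = h r i +ᶻ edge (M r s) (h s) i

  act : Word → State → State
  act []      h = h
  act (s ∷ x) h = fire s (act x h)

  fire-self : ∀ s h i → fire s h s i ≡ -ᶻ h s i
  fire-self s h i with s Finₚ.≟ s
  ... | yes _ = refl
  ... | no ¬p = contradiction refl ¬p

  fire-other : ∀ {s r} h i → r ≢ s → fire s h r i ≡ h r i +ᶻ edge (M r s) (h s) i
  fire-other {s} {r} h i r≢s with r Finₚ.≟ s
  ... | yes p = contradiction p r≢s
  ... | no _  = refl

  fire-cong : ∀ s {h k} → h ≋ k → fire s h ≋ fire s k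
  fire-cong s e r i with r Finₚ.≟ s
  ... | yes _ = cong -ᶻ_ (e s i)
  ... | no _  = cong₂ _+ᶻ_ (e r i) (edge-cong (M r s) (e s) i)

  act-cong : ∀ x {h k} → h ≋ k → act x h ≋ act x k
  act-cong []      e = e
  act-cong (s ∷ x) e = fire-cong s (act-cong x e)

  act-++ : ∀ x y h → act (x ++ y) h ≡ act x (act y h)
  act-++ []      y h = refl
  act-++ (s ∷ x) y h = cong (fire s) (act-++ x y h)

  fire-linear : ∀ s h c k → fire s (λ r i → h r i +ᶻ c *ᶻ k r i) ≋ (λ r i → fire s h r i +ᶻ c *ᶻ fire s k r i)
  fire-linear s h c k r i with r Finₚ.≟ s
  ... | yes _ = l (h s i) c (k s i)
    where
    l : ∀ a c b → -ᶻ (a +ᶻ c *ᶻ b) ≡ -ᶻ a +ᶻ c *ᶻ (-ᶻ b)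
    l = solve-∀
  ... | no _  = trans (cong (h r i +ᶻ c *ᶻ k r i +ᶻ_) (edge-linear (M r s) (h s) c (k s) i)) (l (h r i) _ c (k r i) _)
    where
    l : ∀ a a' c b b' → (a +ᶻ c *ᶻ b) +ᶻ (a' +ᶻ c *ᶻ b') ≡ (a +ᶻ a') +ᶻ c *ᶻ (b +ᶻ b')
    l = solve-∀

  act-linear : ∀ x h c k → act x (λ r i → h r i +ᶻ c *ᶻ k r i) ≋ (λ r i → act x h r i +ᶻ c *ᶻ act x k r i)
  act-linear [] h c k r i = refl
  act-linear (s ∷ x) h c k r i = trans (fire-cong s (act-linear x h c k) r i) (fire-linear s (act x h) c (act x k) r i)

  fire-involutive : ∀ s h → fire s (fire s h) ≋ h
  fire-involutive s h r i with r Finₚ.≟ s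
  ... | yes refl = trans (cong -ᶻ_ (fire-self s h i)) (ℤₚ.neg-involutive (h s i))
  ... | no r≢s   = trans (cong₂ _+ᶻ_ (fire-other h i r≢s) (trans (edge-cong (M r s) (fire-self s h) i) (edge-neg (M r s) (h s) i)))
      (l (h r i) (edge (M r s) (h s) i))
    where
    l : ∀ a b → (a +ᶻ b) +ᶻ (-ᶻ b) ≡ a
    l = solve-∀

  -- Braid relations in the numbers game

  alternating : ℕ → Fin n → Fin n → Word
  alternating zero    p q = []
  alternating (suc k) p q = p ∷ alternating k q p

  letter : ℕ → Fin n → Fin n → Fin n
  letter zero    p q = p
  letter (suc k) p q = letter k q p

  alternating-snoc : ∀ k p q → alternating (suc k) p q ≡ alternating k p q ++ [ letter k p q ]
  alternating-snoc zero    p q = refl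
  alternating-snoc (suc k) p q = cong (p ∷_) (alternating-snoc k q p)

  letter-even : ∀ l p q → letter (l * 2) p q ≡ p
  letter-even zero    p q = refl
  letter-even (suc l) p q = letter-even l p q

  braid-alternating : ∀ l p q → braid l p q ≡ alternating (l * 2) p q
  braid-alternating zero    p q = refl
  braid-alternating (suc l) p q = cong (λ e → p ∷ q ∷ e) (braid-alternating l p q)

  -- Words act from their right end, so for positive `k` the letter fired first is `letter k q p`,
  -- whose initial value is the `β` of `fired`. The vertex just fired carries minus the value it
  -- fired; the other carries the value to be fired next.
  alternating-fired : ∀ k {m} p q h → p ≢ q → M p q ≡ m → M q p ≡ m →
    (∀ i → act (alternating k p q) h p i ≡ -ᶻ fired m (h (letter k p q)) (h (letter k q p)) k i) ×
    (∀ i → act (alternating k p q) h q i ≡ fired m (h (letter k p q)) (h (letter k q p)) (suc k) i)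
  alternating-fired zero p q h ne e e' = (λ i → sym (ℤₚ.neg-involutive (h p i))) , λ i → refl
  alternating-fired (suc k) {m} p q h ne refl e' with alternating-fired k q p h (λ e → ne (sym e)) e' refl
  ... | at-q , at-p = (λ i → trans (fire-self p _ i) (cong -ᶻ_ (at-p i)))
    , λ i → trans (fire-other (act (alternating k q p) h) i (λ e → ne (sym e)))
        (trans (cong₂ _+ᶻ_ (at-q i) (trans (cong (λ e → edge e (act (alternating k q p) h p) i) e') (edge-cong (M p q) at-p i)))
          (ℤₚ.+-comm (-ᶻ fired (M p q) _ _ k i) _))

  double : ∀ l k → l + (l + k) ≡ k + l * 2
  double l k = trans (sym (ℕₚ.+-assoc l l k)) (trans (ℕₚ.+-comm (l + l) k)
    (cong (k +_) (trans (cong (l +_) (sym (ℕₚ.+-identityʳ l))) (ℕₚ.*-comm 2 l))))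

  module Braid {s t : Fin n} (s≢t : s ≢ t) (h : State) where

    value : ℕ → ℕ → ℤ
    value = fired (M s t) (h s) (h t)

    at-first : ∀ l i → act (braid l s t) h s i ≡ -ᶻ value (l * 2) i
    at-first l i = subst₂ (λ w e → act w h s i ≡ -ᶻ e) (sym (braid-alternating l s t))
      (cong₂ (λ a b → fired (M s t) (h a) (h b) (l * 2) i) (letter-even l s t) (letter-even l t s))
      (proj₁ (alternating-fired (l * 2) s t h s≢t refl (M-symmetric t s)) i)

    at-second : ∀ l i → act (braid l s t) h t i ≡ value (suc (l * 2)) i
    at-second l i = subst₂ (λ w e → act w h t i ≡ e) (sym (braid-alternating l s t))
      (cong₂ (λ a b → fired (M s t) (h a) (h b) (suc (l * 2)) i) (letter-even l s t) (letter-even l t s))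
      (proj₂ (alternating-fired (l * 2) s t h s≢t refl (M-symmetric t s)) i)

    total : ℕ → ℕ → ℕ → ℤ
    total l k i = alternate-sum (λ e → value e i) l k

    total-step : ∀ l k i → total (suc l) k i ≡ total l k i +ᶻ value (k + l * 2) i
    total-step l k i = trans (alternate-sum-shift (λ e → value e i) l k) (cong (λ e → total l k i +ᶻ value e i) (double l k))

    -- A vertex outside the pair only receives: from `t` at the odd times and from `s` at the even
    -- ones.
    at-other : ∀ l r → r ≢ s → r ≢ t → ∀ i →
      act (braid l s t) h r i ≡ (h r i +ᶻ edge (M r t) (total l 1) i) +ᶻ edge (M r s) (total l 2) i
    at-other zero r r≢s r≢t i = sym (trans (cong₂ (λ a b → (h r i +ᶻ a) +ᶻ b) (edge-0 (M r t) {total 0 1} (λ _ → refl) i) (edge-0 (M r s) {total 0 2} (λ _ → refl) i))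
      (trans (ℤₚ.+-identityʳ _) (ℤₚ.+-identityʳ _)))
    at-other (suc l) r r≢s r≢t i = begin
      fire s (fire t g) r i
        ≡⟨ fire-other (fire t g) i r≢s ⟩
      fire t g r i +ᶻ edge (M r s) (fire t g s) i
        ≡⟨ cong₂ _+ᶻ_ (fire-other g i r≢t) (edge-cong (M r s) second i) ⟩
      (g r i +ᶻ edge (M r t) (g t) i) +ᶻ edge (M r s) (value (2 + l * 2)) i
        ≡⟨ cong₂ (λ a b → (a +ᶻ b) +ᶻ edge (M r s) (value (2 + l * 2)) i) (at-other l r r≢s r≢t i) (edge-cong (M r t) (at-second l) i) ⟩
      (((h r i +ᶻ edge (M r t) (total l 1) i) +ᶻ edge (M r s) (total l 2) i) +ᶻ edge (M r t) (value (1 + l * 2)) i) +ᶻ edge (M r s) (value (2 + l * 2)) i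
        ≡⟨ shuffle (h r i) _ _ _ _ ⟩
      (h r i +ᶻ (edge (M r t) (total l 1) i +ᶻ edge (M r t) (value (1 + l * 2)) i)) +ᶻ (edge (M r s) (total l 2) i +ᶻ edge (M r s) (value (2 + l * 2)) i)
        ≡⟨ sym (cong₂ (λ a b → (h r i +ᶻ a) +ᶻ b)
             (trans (edge-cong (M r t) (total-step l 1) i) (edge-+ (M r t) (total l 1) (value (1 + l * 2)) i))
             (trans (edge-cong (M r s) (total-step l 2) i) (edge-+ (M r s) (total l 2) (value (2 + l * 2)) i))) ⟩
      (h r i +ᶻ edge (M r t) (total (suc l) 1) i) +ᶻ edge (M r s) (total (suc l) 2) i ∎
      where
      open ≡-Reasoning
      g = act (braid l s t) h
      second : ∀ i → fire t g s i ≡ value (2 + l * 2) i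
      second i = trans (fire-other g i s≢t) (trans (cong₂ _+ᶻ_ (at-first l i) (edge-cong (M s t) (at-second l) i)) (ℤₚ.+-comm (-ᶻ value (l * 2) i) _))
      shuffle : ∀ a b c d e → (((a +ᶻ b) +ᶻ c) +ᶻ d) +ᶻ e ≡ (a +ᶻ (b +ᶻ d)) +ᶻ (c +ᶻ e)
      shuffle = solve-∀

  -- At `s` and `t` this is the period `2m` of the fired values; elsewhere it is the vanishing of
  -- the alternate sums.
  act-braid-distinct : ∀ {s t} → s ≢ t → ∀ d → M s t ≡ suc (suc d) → ∀ h → act (braid (suc (suc d)) s t) h ≋ h
  act-braid-distinct {s} {t} s≢t d eq h r i = at (r Finₚ.≟ s) (r Finₚ.≟ t)
    where
    open Braid s≢t h
    open FiniteEdge d (h s) (h t) using (m; fired-periodic; fired-sum)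
    vanish : ∀ k i → total m k i ≡ 0ℤ
    vanish k i = subst (λ e → alternate-sum (λ l → fired e (h s) (h t) l i) m k ≡ 0ℤ) (sym eq) (fired-sum k i)
    returns : ∀ k → value (k + m * 2) i ≡ value k i
    returns k = trans (cong (λ e → value e i) (sym (double m k)))
      (subst (λ e → fired e (h s) (h t) (m + (m + k)) i ≡ fired e (h s) (h t) k i) (sym eq) (fired-periodic k i))
    at : Dec (r ≡ s) → Dec (r ≡ t) → act (braid m s t) h r i ≡ h r i
    at (yes refl) _ = trans (at-first m i) (trans (cong -ᶻ_ (returns 0)) (ℤₚ.neg-involutive (h s i)))
    at (no _) (yes refl) = trans (at-second m i) (returns 1)
    at (no r≢s) (no r≢t) = trans (at-other m r r≢s r≢t i)
      (trans (cong₂ (λ a b → (h r i +ᶻ a) +ᶻ b) (edge-0 (M r t) (vanish 1) i) (edge-0 (M r s) (vanish 2) i))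
        (trans (ℤₚ.+-identityʳ _) (ℤₚ.+-identityʳ _)))

  act-braid : ∀ s t → M s t ≢ 0 → ∀ h → act (braid (M s t) s t) h ≋ h
  act-braid s t M≢0 h with s Finₚ.≟ t
  ... | yes refl = subst (λ m → act (braid m s s) h ≋ h) (sym (M-diagonal s)) (fire-involutive s h)
  ... | no s≢t with M-offdiagonal s≢t
  ...   | inj₁ e = contradiction e M≢0
  ...   | inj₂ 2≤M = subst (λ m → act (braid m s t) h ≋ h) eq (act-braid-distinct s≢t (M s t ∸ 2) (sym eq) h)
    where
    eq : 2 + (M s t ∸ 2) ≡ M s t
    eq = ℕₚ.m+[n∸m]≡n 2≤M

  act-~ : ∀ {x y} → x ~ y → ∀ h → act x h ≋ act y h
  act-~ (rel a b s t ne) h r i rewrite act-++ a (braid (M s t) s t ++ b) h | act-++ a b h | act-++ (braid (M s t) s t) b h =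
    act-cong a (act-braid s t ne (act b h)) r i
  act-~ ~refl h r i = refl
  act-~ (~sym p) h r i = sym (act-~ p h r i)
  act-~ (~trans p q) h r i = trans (act-~ p h r i) (act-~ q h r i)

  -- The first `i` letters are carried to the other side one by one. Each transfer exchanges the
  -- roles of `p` and `q`, so the parity of `i` selects the alternative.
  alternating-slide : ∀ i k j p q → alternating (i + k) p q ~ alternating j q p →
    (alternating k p q ~ alternating (i + j) q p) ⊎ (alternating k q p ~ alternating (i + j) p q)
  alternating-slide zero k j p q e = inj₁ e
  alternating-slide (suc i) k j p q e with alternating-slide i k (suc j) q p (move-letter e)
  ... | inj₁ f = inj₂ (subst (λ l → alternating k q p ~ alternating l p q) (ℕₚ.+-suc i j) f)
  ... | inj₂ f = inj₁ (subst (λ l → alternating k p q ~ alternating l q p) (ℕₚ.+-suc i j) f)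

  -- The relator of length `2m` is halved by carrying its first `m` letters to the other side.
  alternating-braid : ∀ s t → M s t ≢ 0 → alternating (M s t) s t ~ alternating (M s t) t s
  alternating-braid s t M≢0 with alternating-slide (M s t) (M s t) 0 s t
      (subst (_~ []) (trans (Listₚ.++-identityʳ _) (trans (braid-alternating (M s t) s t) (cong (λ e → alternating e s t) (trans (sym (double (M s t) 0)) (cong (M s t +_) (ℕₚ.+-identityʳ _))))))
        (rel [] [] s t M≢0))
  ... | inj₁ f = subst (λ l → alternating (M s t) s t ~ alternating l t s) (ℕₚ.+-identityʳ _) f
  ... | inj₂ f = ~sym (subst (λ l → alternating (M s t) t s ~ alternating l s t) (ℕₚ.+-identityʳ _) f)

  -- The sign of a word at a generator

  PositiveOn : (Fin n → Set) → State → Set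
  PositiveOn J h = ∀ s → J s → Positive (h s)

  -- Signs are relative to `J` so that they also apply to states known to be positive on `J` only,
  -- such as `act y one` for a minimal coset representative.
  Ascent Descent : (Fin n → Set) → Word → Fin n → Set
  Ascent  J x s = ∀ h → PositiveOn J h → Positive (act x h s)
  Descent J x s = ∀ h → PositiveOn J h → Negative (act x h s)

  data Sign (J : Fin n → Set) (x : Word) (s : Fin n) : Set where
    ascent  : Ascent J x s → Sign J x s
    descent : Descent J x s → ∀ z → All J z → x ~ (s ∷ z) → suc (length z) ≤ length x → Sign J x s

  0<-⇒<0 : ∀ {a b} → a ≡ -ᶻ b → 0ℤ <ᶻ b → a <ᶻ 0ℤ
  0<-⇒<0 refl p = ℤₚ.neg-mono-< p

  <0⇒0< : ∀ {a b} → a ≡ -ᶻ b → a <ᶻ 0ℤ → 0ℤ <ᶻ b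
  <0⇒0< {a} {b} refl p = subst (0ℤ <ᶻ_) (ℤₚ.neg-involutive b) (ℤₚ.neg-mono-< p)

  module SignTheorem (J : Fin n → Set) where

    transport : ∀ {x y s} → x ~ y → length y ≤ length x → Sign J y s → Sign J x s
    transport {s = s} e le (ascent p) = ascent λ h ph i → subst (0ℤ <ᶻ_) (sym (act-~ e h s i)) (p h ph i)
    transport {s = s} e le (descent p z az f lz) = descent (λ h ph i → subst (_<ᶻ 0ℤ) (sym (act-~ e h s i)) (p h ph i))
      z az (~trans e f) (ℕₚ.≤-trans lz le)

    flip : ∀ {x s} → All J x → Sign J x s → Sign J (s ∷ x) s
    flip {x} {s} ax (ascent p) = descent (λ h ph i → 0<-⇒<0 (fire-self s (act x h) i) (p h ph i)) x ax ~refl ℕₚ.≤-refl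
    flip {x} {s} ax (descent p z az e le) = ascent λ h ph i →
      subst (0ℤ <ᶻ_) (sym (fire-self s (act x h) i)) (ℤₚ.neg-mono-< (p h ph i))

    descent⇒ascent : ∀ {x s z} → x ~ (s ∷ z) → Descent J x s → Ascent J z s
    descent⇒ascent {x} {s} {z} e p h ph i = <0⇒0< (trans (act-~ e h s i) (fire-self s (act z h) i)) (p h ph i)

    ¬M≡1 : ∀ {s t} → s ≢ t → M s t ≢ 1
    ¬M≡1 s≢t e with M-offdiagonal s≢t
    ... | inj₁ f = contradiction (trans (sym e) f) λ ()
    ... | inj₂ p = contradiction (subst (2 ≤_) e p) λ { (s≤s ()) }

    letter-J : ∀ k {p q} → J p → J q → J (letter k p q)
    letter-J zero    jp jq = jp
    letter-J (suc k) jp jq = letter-J k jq jp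

    alternating-J : ∀ k {p q} → J p → J q → All J (alternating k p q)
    alternating-J zero    jp jq = []
    alternating-J (suc k) jp jq = jp ∷ alternating-J k jq jp

    length-alternating : ∀ k p q → length (alternating k p q) ≡ k
    length-alternating zero p q = refl
    length-alternating (suc k) p q = cong suc (length-alternating k q p)

    length-alternating-++ : ∀ k p q y → length (alternating k p q ++ y) ≡ k + length y
    length-alternating-++ k p q y = trans (Listₚ.length-++ (alternating k p q)) (cong (_+ length y) (length-alternating k p q))

    sharpen : ∀ {a m} → a ≢ m → (m ≡ 0) ⊎ (a ≤ m) → (m ≡ 0) ⊎ (suc a ≤ m)
    sharpen a≢m (inj₁ m≡0) = inj₁ m≡0
    sharpen a≢m (inj₂ a≤m) = inj₂ (ℕₚ.≤∧≢⇒< a≤m a≢m)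

    -- A first letter `s` reverses the sign of the tail. For a first letter `t ≠ s`, a descent of
    -- the tail at `t` shortens the word; otherwise `peel` reduces the question to the dihedral
    -- subgroup of `s` and `t`.
    sign-bounded : ∀ N x → length x ≤ N → All J x → ∀ {s} → J s → Sign J x s

    -- Strips letters from the left of y, so as to reach the minimal representative of
    -- the coset of x by the parabolic subgroup of s and t.
    peel : ∀ N k {s t} x j y → s ≢ t → J s → J t → length x ≤ suc N → All J y → length y ≤ k →
      x ~ (alternating (suc j) t s ++ y) → suc j + length y ≤ length x →
      (M t s ≡ 0) ⊎ (suc j ≤ M t s) → Ascent J y (letter j t s) → Sign J x s

    sign-bounded N [] _ _ js = ascent λ h ph → ph _ js
    sign-bounded (suc N) (t ∷ x) (s≤s le) (jt ∷ ax) {s} js with s Finₚ.≟ t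
    ... | yes refl = flip ax (sign-bounded N x le ax js)
    ... | no s≢t with sign-bounded N x le ax jt
    ...   | descent p z az e lz = transport (~trans (∷-cong t e) (involution t z))
            (ℕₚ.≤-trans (ℕₚ.<⇒≤ lz) (ℕₚ.n≤1+n _)) (sign-bounded N z (ℕₚ.≤-trans (ℕₚ.<⇒≤ lz) le) az js)
    ...   | ascent p = peel N (length x) (t ∷ x) 0 x s≢t js jt (s≤s le) ax ℕₚ.≤-refl ~refl ℕₚ.≤-refl (start (M-offdiagonal (λ e → s≢t (sym e)))) p
      where
      start : ∀ {m} → (m ≡ 0) ⊎ (2 ≤ m) → (m ≡ 0) ⊎ (1 ≤ m)
      start (inj₁ e) = inj₁ e
      start (inj₂ q) = inj₂ (ℕₚ.<⇒≤ q)

    peel N k {s} {t} x j y s≢t js jt lx ay ly e le bound p with suc j ℕₚ.≟ M t s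
    -- The alternating word has full length `m`, so the braid relation lets it begin with `s`; the
    -- sign of the shorter remainder is then reversed.
    ... | yes j≡m = transport (~trans e (++-congʳ y swap)) lz′ (flip az (sign-bounded N z lz az js))
      where
      z : Word
      z = alternating j t s ++ y
      az : All J z
      az = Allₚ.++⁺ (alternating-J j jt js) ay
      lz′ : suc (length z) ≤ length x
      lz′ = ℕₚ.≤-trans (ℕₚ.≤-reflexive (cong suc (length-alternating-++ j t s y))) le
      lz : length z ≤ N
      lz = ℕₚ.≤-pred (ℕₚ.≤-trans lz′ lx)
      swap : alternating (suc j) t s ~ alternating (suc j) s t
      swap = subst (λ m → alternating m t s ~ alternating m s t) (sym j≡m)
        (alternating-braid t s (λ f → contradiction (trans j≡m f) λ ()))
    ... | no j≢m with sign-bounded N y (ℕₚ.≤-trans (ℕₚ.m≤n+m (length y) j) (ℕₚ.≤-pred (ℕₚ.≤-trans le lx))) ay (letter-J j js jt)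
    -- Now `y` has ascents at both letters, so the dihedral game starts from a positive state. Fewer
    -- than `m` letters are played when `m` is finite, so the next value is positive.
    ...   | ascent q = ascent λ h ph i → subst (0ℤ <ᶻ_)
              (sym (trans (act-~ e h s i) (trans (cong (λ g → g s i) (act-++ (alternating (suc j) t s) y h))
                (proj₂ (alternating-fired (suc j) t s (act y h) (λ f → s≢t (sym f)) refl (M-symmetric s t)) i))))
              (fired-positive (M t s) _ _ (¬M≡1 (λ f → s≢t (sym f))) (q h ph) (p h ph) (suc j) (sharpen j≢m bound) i)
    peel N zero x j [] s≢t js jt lx ay ly e le bound p | no j≢m | descent q z az f ()
    peel N zero x j (_ ∷ _) s≢t js jt lx ay () e le bound p | no j≢m | descent q z az f lz
    peel N (suc k) {s} {t} x j y s≢t js jt lx ay ly e le bound p | no j≢m | descent q z az f lz =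
      -- The letter split off `y` prolongs the alternation, and once this descent is removed the
      -- rest has an ascent there, which restores the invariant.
      peel N k x (suc j) z s≢t js jt lx az (ℕₚ.≤-pred (ℕₚ.≤-trans lz ly))
        (~trans e (~trans (++-congˡ (alternating (suc j) t s) f) (≡⇒~ (trans (sym (Listₚ.++-assoc (alternating (suc j) t s) [ letter j s t ] z))
          (cong (_++ z) (sym (alternating-snoc (suc j) t s)))))))
        (ℕₚ.≤-trans (ℕₚ.≤-reflexive (sym (ℕₚ.+-suc (suc j) (length z)))) (ℕₚ.≤-trans (ℕₚ.+-monoʳ-≤ (suc j) lz) le))
        (sharpen j≢m bound) (descent⇒ascent f q)

    sign : ∀ x → All J x → ∀ {s} → J s → Sign J x s
    sign x = sign-bounded (length x) x ℕₚ.≤-refl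

  -- Reduced words and length

  Every : Fin n → Set
  Every _ = ⊤

  all-every : ∀ x → All Every x
  all-every x = All.universal (λ _ → tt) x

  sign : ∀ x s → Sign Every x s
  sign x s = SignTheorem.sign Every x (all-every x) tt

  one : State
  one _ _ = 1ℤ

  one-positive : ∀ {J} → PositiveOn J one
  one-positive _ _ _ = ℤ.+<+ (s≤s z≤n)

  not-both : ∀ {a} → Positive a → ¬ Negative a
  not-both p q = ℤₚ.<-asym (p 0) (q 0)

  act-self-negative : ∀ {x s h} → Positive (act x h s) → Negative (act (s ∷ x) h s)
  act-self-negative {x} {s} {h} p i = subst (_<ᶻ 0ℤ) (sym (fire-self s (act x h) i)) (ℤₚ.neg-mono-< (p i))

  act-self-positive : ∀ {x s h} → Negative (act x h s) → Positive (act (s ∷ x) h s)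
  act-self-positive {x} {s} {h} p i = subst (0ℤ <ᶻ_) (sym (fire-self s (act x h) i)) (ℤₚ.neg-mono-< (p i))

  Positive-~ : ∀ {x y s h} → x ~ y → Positive (act x h s) → Positive (act y h s)
  Positive-~ {s = s} {h} e p i = subst (0ℤ <ᶻ_) (act-~ e h s i) (p i)

  Negative-~ : ∀ {x y s h} → x ~ y → Negative (act x h s) → Negative (act y h s)
  Negative-~ {s = s} {h} e p i = subst (_<ᶻ 0ℤ) (act-~ e h s i) (p i)

  ∷-cancel : ∀ {s x y} → (s ∷ x) ~ (s ∷ y) → x ~ y
  ∷-cancel {s} {x} {y} e = ~trans (move-letter e) (involution s y)

  abstract
    -- If the reduced word `r` has an ascent at `t`, every word for `t x` has a descent there and so
    -- yields a shorter word for `x`. If it has a descent, the word `w` that comes with it is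
    -- already shortest.
    geodesic : ∀ x → Σ Word λ y → (y ~ x) × (∀ z → z ~ x → length y ≤ length z)
    geodesic [] = [] , ~refl , λ _ _ → z≤n
    geodesic (t ∷ x) with geodesic x
    ... | r , e , minimal with sign r t
    ...   | ascent p = t ∷ r , ∷-cong t e , shortest
      where
      shortest : ∀ z → z ~ (t ∷ x) → suc (length r) ≤ length z
      shortest z f with sign z t
      ... | descent _ w _ g le = ℕₚ.≤-trans (s≤s (minimal w (∷-cancel (~trans (~sym g) f)))) le
      ... | ascent q = contradiction (act-self-negative {r} (p one one-positive))
            (not-both (Positive-~ (~trans f (∷-cong t (~sym e))) (q one one-positive)))
    ...   | descent p w _ g le = w , ~trans (move-letter (~sym g)) (∷-cong t e) , λ z f →
            ℕₚ.≤-pred (ℕₚ.≤-trans le (minimal (t ∷ z) (~sym (move-letter (~sym f)))))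

  geo : Word → Word
  geo x = proj₁ (geodesic x)

  geo-~ : ∀ x → geo x ~ x
  geo-~ x = proj₁ (proj₂ (geodesic x))

  ℓ : Word → ℕ
  ℓ x = length (geo x)

  ℓ-minimal : ∀ {x y} → y ~ x → ℓ x ≤ length y
  ℓ-minimal {x} {y} = proj₂ (proj₂ (geodesic x)) y

  ℓ≤length : ∀ x → ℓ x ≤ length x
  ℓ≤length x = ℓ-minimal ~refl

  ℓ-[] : ℓ [] ≡ 0
  ℓ-[] = ℕₚ.n≤0⇒n≡0 (ℓ≤length [])

  ℓ-cong : ∀ {x y} → x ~ y → ℓ x ≡ ℓ y
  ℓ-cong {x} {y} e = ℕₚ.≤-antisym (ℓ-minimal (~trans (geo-~ y) (~sym e))) (ℓ-minimal (~trans (geo-~ x) e))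

  ℓ-HasLength : ∀ x → HasLength x (ℓ x)
  ℓ-HasLength x = (geo x , geo-~ x , refl) , λ y → ℓ-minimal

  HasLength-ℓ : ∀ {x k} → HasLength x k → k ≡ ℓ x
  HasLength-ℓ {x} ((y , e , refl) , minimal) = ℕₚ.≤-antisym (minimal (geo x) (geo-~ x)) (ℓ-minimal e)

  ℓ≡0⇒~[] : ∀ {x} → ℓ x ≡ 0 → x ~ []
  ℓ≡0⇒~[] {x} e with geo x | geo-~ x
  ... | [] | f = ~sym f

  ~⇒inv : ∀ {x y} → x ~ y → (inv x ++ y) ~ []
  ~⇒inv {x} {y} e = ~trans (++-congˡ (inv x) (~sym e)) (inverseˡ x)

  inv⇒~ : ∀ {x y} → (inv x ++ y) ~ [] → x ~ y
  inv⇒~ {x} {y} e = ~sym (~trans (~sym (cancelˡ′ x y)) (~trans (++-congˡ x e) (≡⇒~ (Listₚ.++-identityʳ x))))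

  infix 4 _~?_
  _~?_ : ∀ x y → Dec (x ~ y)
  x ~? y with ℓ (inv x ++ y) ℕₚ.≟ 0
  ... | yes e = yes (inv⇒~ (ℓ≡0⇒~[] e))
  ... | no ¬e = no λ e → ¬e (trans (ℓ-cong (~⇒inv e)) ℓ-[])

  ℓ-++-≤ : ∀ x y → ℓ (x ++ y) ≤ ℓ x + ℓ y
  ℓ-++-≤ x y = ℕₚ.≤-trans (ℓ-minimal (~trans (++-congʳ (geo y) (geo-~ x)) (++-congˡ x (geo-~ y))))
    (ℕₚ.≤-reflexive (Listₚ.length-++ (geo x)))

  ℓ-inv-≤ : ∀ x → ℓ (inv x) ≤ ℓ x
  ℓ-inv-≤ x = ℕₚ.≤-trans (ℓ-minimal (inv-cong (geo-~ x))) (ℕₚ.≤-reflexive (Listₚ.length-reverse (geo x)))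

  ℓ-inv : ∀ x → ℓ (inv x) ≡ ℓ x
  ℓ-inv x = ℕₚ.≤-antisym (ℓ-inv-≤ x) (subst (λ e → ℓ e ≤ ℓ (inv x)) (inv-inv x) (ℓ-inv-≤ (inv x)))

  ℓ-∷-≤ : ∀ s x → ℓ (s ∷ x) ≤ suc (ℓ x)
  ℓ-∷-≤ s x = ℓ-minimal (∷-cong s (geo-~ x))

  ℓ-≤-∷ : ∀ s x → ℓ x ≤ suc (ℓ (s ∷ x))
  ℓ-≤-∷ s x = ℕₚ.≤-trans (ℕₚ.≤-reflexive (ℓ-cong (~sym (involution s x)))) (ℓ-∷-≤ s (s ∷ x))

  ascent-length : ∀ {x s} y → Ascent Every x s → y ~ (s ∷ x) → suc (ℓ x) ≤ length y
  ascent-length {x} {s} y p f with sign y s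
  ... | ascent q = contradiction (act-self-negative {x} (p one one-positive)) (not-both (Positive-~ f (q one one-positive)))
  ... | descent _ w _ e le = ℕₚ.≤-trans (s≤s (ℓ-minimal (∷-cancel (~trans (~sym e) f)))) le

  descent-length : ∀ {x s} y → Descent Every x s → y ~ x → suc (ℓ (s ∷ x)) ≤ length y
  descent-length {x} {s} y p f with sign y s
  ... | ascent q = contradiction (p one one-positive) (not-both (Positive-~ f (q one one-positive)))
  ... | descent _ w _ e le = ℕₚ.≤-trans (s≤s (ℓ-minimal (move-letter (~trans (~sym e) f)))) le

  dichotomy : ∀ x s → (Ascent Every x s × ℓ (s ∷ x) ≡ suc (ℓ x)) ⊎ (Descent Every x s × ℓ x ≡ suc (ℓ (s ∷ x)))
  dichotomy x s = classify (sign x s)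
    where
    classify : Sign Every x s → (Ascent Every x s × ℓ (s ∷ x) ≡ suc (ℓ x)) ⊎ (Descent Every x s × ℓ x ≡ suc (ℓ (s ∷ x)))
    classify (ascent p) = inj₁ (p , ℕₚ.≤-antisym (ℓ-∷-≤ s x) (ascent-length (geo (s ∷ x)) p (geo-~ (s ∷ x))))
    classify (descent p _ _ _ _) = inj₂ (p , ℕₚ.≤-antisym (ℓ-≤-∷ s x) (descent-length (geo x) p (geo-~ x)))

  positive⇒up : ∀ {x s} → Positive (act x one s) → ℓ (s ∷ x) ≡ suc (ℓ x)
  positive⇒up {x} {s} p with dichotomy x s
  ... | inj₁ (_ , e) = e
  ... | inj₂ (q , _) = contradiction (q one one-positive) (not-both p)

  negative⇒down : ∀ {x s} → Negative (act x one s) → ℓ x ≡ suc (ℓ (s ∷ x))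
  negative⇒down {x} {s} p with dichotomy x s
  ... | inj₁ (q , _) = contradiction p (not-both (q one one-positive))
  ... | inj₂ (_ , e) = e

  up⇒ascent : ∀ {x s} → ℓ x < ℓ (s ∷ x) → Ascent Every x s
  up⇒ascent {x} {s} lt with dichotomy x s
  ... | inj₁ (p , _) = p
  ... | inj₂ (_ , e) = contradiction lt (ℕₚ.<-asym (ℕₚ.≤-reflexive (sym e)))

  down⇒descent : ∀ {x s} → ℓ (s ∷ x) < ℓ x → Descent Every x s
  down⇒descent {x} {s} lt with dichotomy x s
  ... | inj₂ (p , _) = p
  ... | inj₁ (_ , e) = contradiction lt (ℕₚ.<-asym (ℕₚ.≤-reflexive (sym e)))

  ℓ-∷-≢ : ∀ s x → ℓ (s ∷ x) ≢ ℓ x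
  ℓ-∷-≢ s x e with dichotomy x s
  ... | inj₁ (_ , f) = ℕₚ.1+n≢n (trans (sym f) e)
  ... | inj₂ (_ , f) = ℕₚ.1+n≢n (trans (sym f) (sym e))

  -- Walls, folding and exchange

  -- By positivity of the action on h + N k for all N, with h positive.
  ascent-nonnegative : ∀ {x s} → Ascent Every x s → ∀ k → (∀ r → NonNegative (k r)) → NonNegative (act x k s)
  ascent-nonnegative {x} {s} p k k≥0 i with 0ℤ ℤₚ.≤? act x k s i
  ... | yes q = q
  ... | no ¬q = contradiction positive (ℤₚ.≤⇒≯ nonpositive)
    where
    a b : ℤ
    a = act x one s i
    b = act x k s i
    N : ℤ
    -- A negative integer `b` is at most -1, so this choice makes `a + N b` nonpositive.
    N = pos ℤ.∣ a ∣
    N≥0 : 0ℤ ≤ᶻ N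
    N≥0 = ℤ.+≤+ z≤n
    instance _ = ℤ.nonNegative N≥0
    positive : 0ℤ <ᶻ a +ᶻ N *ᶻ b
    positive = subst (0ℤ <ᶻ_) (act-linear x one N k s i) (p (λ r i → 1ℤ +ᶻ N *ᶻ k r i)
      (λ r _ i → 0<-+ (ℤ.+<+ (s≤s z≤n)) (subst (_≤ᶻ N *ᶻ k r i) (ℤₚ.*-zeroʳ N) (ℤₚ.*-monoˡ-≤-nonNeg N (k≥0 r i)))) i)
    nonpositive : a +ᶻ N *ᶻ b ≤ᶻ 0ℤ
    nonpositive = ℤₚ.≤-trans (ℤₚ.+-mono-≤ (a≤∣a∣ a) (ℤₚ.*-monoˡ-≤-nonNeg N (ℤₚ.i<j⇒i≤pred[j] (ℤₚ.≰⇒> ¬q)))) (ℤₚ.≤-reflexive (c N))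
      where
      a≤∣a∣ : ∀ a → a ≤ᶻ pos ℤ.∣ a ∣
      a≤∣a∣ (pos _) = ℤₚ.≤-refl
      a≤∣a∣ -[1+ _ ] = ℤ.-≤+
      c : ∀ N → N +ᶻ N *ᶻ -[1+ 0 ] ≡ 0ℤ
      c = solve-∀

  fire-zero : ∀ {s h} → (∀ i → h s i ≡ 0ℤ) → fire s h ≋ h
  fire-zero {s} {h} z r i with r Finₚ.≟ s
  ... | yes refl = trans (cong -ᶻ_ (z i)) (sym (z i))
  ... | no _ = trans (cong (h r i +ᶻ_) (edge-0 (M r s) z i)) (ℤₚ.+-identityʳ _)

  -- A generic point of the wall of r.
  wall : Fin n → State
  wall r q i with q Finₚ.≟ r
  ... | yes _ = 0ℤ
  ... | no _  = 1ℤ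

  wall-self : ∀ r i → wall r r i ≡ 0ℤ
  wall-self r i with r Finₚ.≟ r
  ... | yes _ = refl
  ... | no ¬p = contradiction refl ¬p

  wall-nonnegative : ∀ r q → NonNegative (wall r q)
  wall-nonnegative r q i with q Finₚ.≟ r
  ... | yes _ = ℤₚ.≤-refl
  ... | no _  = ℤ.+≤+ z≤n

  wall-zero : ∀ r q i → wall r q i ≤ᶻ 0ℤ → q ≡ r
  wall-zero r q i p with q Finₚ.≟ r
  ... | yes e = e
  wall-zero r q i (ℤ.+≤+ ()) | no _

  -- A descent of the tail at the first letter `q` shortens the word. At an ascent, firing `q`
  -- leaves a nonpositive value there, but the wall point has such a value only at `r`. So `q = r`,
  -- the value fired is zero, and the tail fixes the wall point too.
  wall-stabilizer : ∀ r N x → length x ≤ N → act x (wall r) ≋ wall r → (x ~ []) ⊎ (x ~ [ r ])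
  wall-stabilizer r N [] _ _ = inj₁ ~refl
  wall-stabilizer r (suc N) (q ∷ x) (s≤s le) fixed with sign x q
  ... | descent _ z _ e lz = Sum.map (~trans q∷x~z) (~trans q∷x~z)
        (wall-stabilizer r N z (ℕₚ.≤-trans (ℕₚ.<⇒≤ lz) le) λ s i → trans (sym (act-~ q∷x~z (wall r) s i)) (fixed s i))
    where
    q∷x~z : (q ∷ x) ~ z
    q∷x~z = ~trans (∷-cong q e) (involution q z)
  ... | ascent p with wall-zero r q 0 (subst (_≤ᶻ 0ℤ) (trans (sym (fire-self q (act x (wall r)) 0)) (fixed q 0))
                   (ℤₚ.neg-mono-≤ (ascent-nonnegative {x} p (wall r) (wall-nonnegative r) 0)))
  ...   | refl = extend (wall-stabilizer r N x le λ s i → trans (sym (fire-zero {h = act x (wall r)} zero-at s i)) (fixed s i))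
    where
    zero-at : ∀ i → act x (wall r) r i ≡ 0ℤ
    zero-at i = trans (sym (ℤₚ.neg-involutive _)) (cong -ᶻ_ (trans (sym (fire-self r (act x (wall r)) i)) (trans (fixed r i) (wall-self r i))))
    extend : (x ~ []) ⊎ (x ~ [ r ]) → ((r ∷ x) ~ []) ⊎ ((r ∷ x) ~ [ r ])
    extend (inj₁ e) = inj₂ (∷-cong r e)
    extend (inj₂ e) = inj₁ (~trans (∷-cong r e) (involution r []))

  -- The generator `r` fixes its wall point, so `y` and `y r` send that point to the same state, and
  -- the opposite signs squeeze the value at `t` to zero. Hence `y⁻¹ t y` fixes the wall point and
  -- is trivial or `r`; it is not trivial because `t` changes the length of `y`.
  folding : ∀ {y t r} → Ascent Every y t → Descent Every (y ++ [ r ]) t → (t ∷ y) ~ (y ++ [ r ])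
  folding {y} {t} {r} p q with wall-stabilizer r _ (inv y ++ t ∷ y) ℕₚ.≤-refl fixed
    where
    h = wall r
    same : act (y ++ [ r ]) h ≋ act y h
    same s i = trans (cong (λ g → g s i) (act-++ y [ r ] h)) (act-cong y (fire-zero (wall-self r)) s i)
    on-wall : ∀ i → act y h t i ≡ 0ℤ
    on-wall i = ℤₚ.≤-antisym
      (subst (_≤ᶻ 0ℤ) (same t i) (subst (_≤ᶻ 0ℤ) (ℤₚ.neg-involutive _)
        (ℤₚ.neg-mono-≤ (subst (0ℤ ≤ᶻ_) (fire-self t (act (y ++ [ r ]) h) i)
          (ascent-nonnegative {t ∷ y ++ [ r ]} {t} (λ g pg → act-self-positive {y ++ [ r ]} (q g pg)) h (wall-nonnegative r) i)))))
      (ascent-nonnegative {y} p h (wall-nonnegative r) i)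
    fixed : act (inv y ++ t ∷ y) h ≋ h
    fixed s i = trans (cong (λ g → g s i) (act-++ (inv y) (t ∷ y) h))
      (trans (act-cong (inv y) (fire-zero {h = act y h} on-wall) s i)
        (trans (cong (λ g → g s i) (sym (act-++ (inv y) y h))) (act-~ (inverseˡ y) h s i)))
  ... | inj₁ e = contradiction (sym (ℓ-cong (inv⇒~ e))) (ℓ-∷-≢ t y)
  ... | inj₂ e = ~trans (~sym (cancelˡ′ y (t ∷ y))) (++-congˡ y e)

  -- Among the prefixes, `folding` deletes the letter at which an ascent at `t` turns into a
  -- descent. The prefix `p` is kept apart to control where this letter lies.
  exchange : ∀ p x t → Descent Every (p ++ x) t →
    Descent Every p t ⊎ ∃[ x′ ] ((suc (length x′) ≡ length x) × ((t ∷ p ++ x) ~ (p ++ x′)))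
  exchange p [] t d = inj₁ (subst (λ e → Descent Every e t) (Listₚ.++-identityʳ p) d)
  exchange p (r ∷ x) t d with exchange (p ++ [ r ]) x t (subst (λ e → Descent Every e t) (sym (Listₚ.++-assoc p [ r ] x)) d)
  ... | inj₂ (x′ , e , f) = inj₂ (r ∷ x′ , cong suc e ,
        subst₂ (λ a b → (t ∷ a) ~ b) (Listₚ.++-assoc p [ r ] x) (Listₚ.++-assoc p [ r ] x′) f)
  ... | inj₁ d′ with dichotomy p t
  ...   | inj₂ (d″ , _) = inj₁ d″
  ...   | inj₁ (a , _) = inj₂ (x , refl , ~trans (++-congʳ (r ∷ x) (folding {p} {t} {r} a d′))
            (~trans (≡⇒~ (Listₚ.++-assoc p [ r ] (r ∷ x))) (++-congˡ p (involution r x))))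

  -- Parabolic subgroups and coset representatives

  -- A vertex outside `J` is never fired. It receives nonnegative amounts from ascents, and at a
  -- descent the word is shortened first.
  support : ∀ {J} N x → length x ≤ N → All J x → ∀ {s} → ¬ J s → Positive (act x one s)
  support N [] _ _ _ _ = ℤ.+<+ (s≤s z≤n)
  support {J} (suc N) (t ∷ x) (s≤s le) (jt ∷ ax) {s} ¬js with SignTheorem.sign J x ax jt
  ... | ascent p = λ i → subst (0ℤ <ᶻ_) (sym (fire-other (act x one) i (λ { refl → ¬js jt })))
        (0<-+ (support N x le ax ¬js i) (edge-≥0 (M s t) (λ i → ℤₚ.<⇒≤ (p one one-positive i)) i))
  ... | descent _ z az e lz = Positive-~ (~trans (~sym (involution t z)) (∷-cong t (~sym e)))
        (support N z (ℕₚ.≤-trans (ℕₚ.<⇒≤ lz) le) az ¬js)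

  parabolic-ascent : ∀ {J x s} → All J x → ¬ J s → Ascent Every x s
  parabolic-ascent {J} {x} {s} ax ¬js with dichotomy x s
  ... | inj₁ (p , _) = p
  ... | inj₂ (q , _) = contradiction (q one one-positive) (not-both (support _ x ℕₚ.≤-refl ax ¬js))

  -- Both `one` and `act y one` are positive on `J`, so the sign relative to `J` settles both at
  -- once: every letter of `w` changes the two lengths alike.
  coset-length : ∀ {J y} → (∀ t → J t → Positive (act y one t)) → ∀ w → All J w → ℓ (w ++ y) ≡ ℓ w + ℓ y
  coset-length {y = y} p [] _ = cong (_+ ℓ y) (sym ℓ-[])
  coset-length {J} {y} p (q ∷ w) (jq ∷ aw) with SignTheorem.sign J w aw jq | coset-length p w aw
  ... | ascent a | ih = trans (positive⇒up (subst (λ g → Positive (g q)) (sym (act-++ w y one)) (a (act y one) p)))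
        (trans (cong suc ih) (cong (_+ ℓ y) (sym (positive⇒up {w} (a one one-positive)))))
  ... | descent d _ _ _ _ | ih = ℕₚ.suc-injective (trans (sym (negative⇒down (subst (λ g → Negative (g q)) (sym (act-++ w y one)) (d (act y one) p))))
        (trans ih (cong (_+ ℓ y) (negative⇒down {w} (d one one-positive)))))

  -- The first letter of a reduced word is a descent, and elements of the parabolic subgroup have
  -- ascents outside `J`. Membership is thus reached by contradiction, whence the stability
  -- hypothesis.
  geodesic-letters : ∀ {J} → (∀ q → ¬ ¬ J q → J q) → ∀ y x → length y ≤ ℓ y → y ~ x → All J x → All J y
  geodesic-letters stable [] x _ _ _ = []
  geodesic-letters {J} stable (q ∷ y) x le e ax = jq ∷ geodesic-letters stable y (q ∷ x) ly (move-letter e) (jq ∷ ax)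
    where
    ly : length y ≤ ℓ y
    ly = ℕₚ.≤-pred (ℕₚ.≤-trans le (ℓ-∷-≤ q y))
    jq : J q
    jq = stable q λ ¬jq → not-both (parabolic-ascent ax ¬jq one one-positive)
      (Negative-~ e (act-self-negative {y} (up⇒ascent {y} (ℕₚ.≤-trans (s≤s (ℓ≤length y)) le) one one-positive)))

  All-inv : ∀ {J : Fin n → Set} {x} → All J x → All J (inv x)
  All-inv {x = x} = All-resp-↭ (↭-sym (↭-reverse x))

  ℓ-snoc : ∀ y t → ℓ (y ++ [ t ]) ≡ ℓ (t ∷ inv y)
  ℓ-snoc y t = trans (sym (ℓ-inv (y ++ [ t ]))) (cong ℓ (inv-++ y [ t ]))

  ℓ-snoc-≢ : ∀ y t → ℓ (y ++ [ t ]) ≢ ℓ y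
  ℓ-snoc-≢ y t e = ℓ-∷-≢ t (inv y) (trans (sym (ℓ-snoc y t)) (trans e (sym (ℓ-inv y))))

  snoc-involution : ∀ x t → x ~ ((x ++ [ t ]) ++ [ t ])
  snoc-involution x t = ~sym (~trans (≡⇒~ (Listₚ.++-assoc x [ t ] [ t ]))
    (~trans (++-congˡ x (involution t [])) (≡⇒~ (Listₚ.++-identityʳ x))))

  ℓ-snoc-≤ : ∀ y t → ℓ (y ++ [ t ]) ≤ suc (ℓ y)
  ℓ-snoc-≤ y t = subst₂ _≤_ (sym (ℓ-snoc y t)) (cong suc (ℓ-inv y)) (ℓ-∷-≤ t (inv y))

  ℓ-≤-snoc : ∀ y t → ℓ y ≤ suc (ℓ (y ++ [ t ]))
  ℓ-≤-snoc y t = subst₂ _≤_ (ℓ-inv y) (cong suc (sym (ℓ-snoc y t))) (ℓ-≤-∷ t (inv y))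

  Minimal : (Fin n → Set) → Word → Set
  Minimal J y = ∀ t → J t → ℓ y < ℓ (y ++ [ t ])

  minimal-coset-length : ∀ {J y z} → Minimal J y → All J z → ℓ (y ++ z) ≡ ℓ y + ℓ z
  minimal-coset-length {J} {y} {z} minimal az = begin
    ℓ (y ++ z)               ≡⟨ ℓ-inv (y ++ z) ⟨
    ℓ (inv (y ++ z))         ≡⟨ cong ℓ (inv-++ y z) ⟩
    ℓ (inv z ++ inv y)       ≡⟨ coset-length positive (inv z) (All-inv az) ⟩
    ℓ (inv z) + ℓ (inv y)    ≡⟨ cong₂ _+_ (ℓ-inv z) (ℓ-inv y) ⟩
    ℓ z + ℓ y                ≡⟨ ℕₚ.+-comm (ℓ z) (ℓ y) ⟩
    ℓ y + ℓ z                ∎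
    where
    open ≡-Reasoning
    positive : ∀ t → J t → Positive (act (inv y) one t)
    positive t jt = up⇒ascent {inv y} (subst₂ _<_ (sym (ℓ-inv y)) (ℓ-snoc y t) (minimal t jt)) one one-positive

  -- Additivity of lengths from `y` to `y′` and back gives `ℓ y + ℓ z + ℓ (inv z) = ℓ y`.
  minimal-unique : ∀ {J y y′ z} → Minimal J y → Minimal J y′ → All J z → y′ ~ (y ++ z) → y ~ y′
  minimal-unique {J} {y} {y′} {z} my my′ az e = ~sym (~trans e (~trans (++-congˡ y (ℓ≡0⇒~[] z≡0)) (≡⇒~ (Listₚ.++-identityʳ y))))
    where
    back : y ~ (y′ ++ inv z)
    back = ~sym (~trans (++-congʳ (inv z) e) (cancelʳ y z))
    z≡0 : ℓ z ≡ 0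
    z≡0 = ℕₚ.m+n≡0⇒m≡0 (ℓ z) (ℕₚ.+-cancelˡ-≡ (ℓ y) _ 0 (trans (sym (ℕₚ.+-assoc (ℓ y) (ℓ z) (ℓ (inv z))))
      (trans (cong (_+ ℓ (inv z)) (sym (trans (ℓ-cong e) (minimal-coset-length my az))))
        (trans (sym (trans (ℓ-cong back) (minimal-coset-length my′ (All-inv az)))) (sym (ℕₚ.+-identityʳ (ℓ y)))))))

  -- As long as there is a right descent other than `s`, it is moved into the parabolic factor;
  -- finite rank makes the search decidable.
  parabolic-decomposition : ∀ s N x → ℓ x ≤ N → Σ Word λ y → Σ Word λ z → Minimal (_≢ s) y × All (_≢ s) z × (x ~ (y ++ z))
  parabolic-decomposition s N x le with Finₚ.any? (λ t → ¬? (t Finₚ.≟ s) ×-dec (ℓ (x ++ [ t ]) ℕₚ.<? ℓ x))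
  ... | no none = x , [] , (λ t t≢s → ℕₚ.≤∧≢⇒< (ℕₚ.≮⇒≥ λ lt → none (t , t≢s , lt)) λ e → ℓ-snoc-≢ x t (sym e))
        , [] , ≡⇒~ (sym (Listₚ.++-identityʳ x))
  parabolic-decomposition s zero x le | yes (t , t≢s , lt) with () ← ℕₚ.≤-trans lt le
  parabolic-decomposition s (suc N) x le | yes (t , t≢s , lt) with parabolic-decomposition s N (x ++ [ t ]) (ℕₚ.≤-pred (ℕₚ.≤-trans lt le))
  ... | y , z , my , az , e = y , z ++ [ t ] , my , Allₚ.++⁺ az (t≢s ∷ [])
        , ~trans (snoc-involution x t) (~trans (++-congʳ [ t ] e) (≡⇒~ (Listₚ.++-assoc y z [ t ])))

  abstract
    decompose : ∀ s x → Σ Word λ y → Σ Word λ z → Minimal (_≢ s) y × All (_≢ s) z × (x ~ (y ++ z))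
    decompose s x = parabolic-decomposition s (ℓ x) x ℕₚ.≤-refl

  P R : Fin n → Word → Word
  P s x = proj₁ (decompose s x)
  R s x = proj₁ (proj₂ (decompose s x))

  P-minimal : ∀ s x → Minimal (_≢ s) (P s x)
  P-minimal s x = proj₁ (proj₂ (proj₂ (decompose s x)))

  R-parabolic : ∀ s x → All (_≢ s) (R s x)
  R-parabolic s x = proj₁ (proj₂ (proj₂ (proj₂ (decompose s x))))

  PR-~ : ∀ s x → x ~ (P s x ++ R s x)
  PR-~ s x = proj₂ (proj₂ (proj₂ (proj₂ (decompose s x))))

  isP : ∀ {s x y z} → Minimal (_≢ s) y → All (_≢ s) z → x ~ (y ++ z) → IsP s x y
  isP {s} {x} {y} {z} my az e =
      (λ t jt a b la lb → subst₂ _<_ (sym (HasLength-ℓ la)) (sym (HasLength-ℓ lb)) (my t jt))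
    , (z , z~ , az)
    , ℓ x , ℓ y , ℓ (inv y ++ x) , ℓ-HasLength x , ℓ-HasLength y , ℓ-HasLength (inv y ++ x)
    , trans (ℓ-cong e) (trans (minimal-coset-length my az) (cong (ℓ y +_) (ℓ-cong z~)))
    where
    z~ : z ~ (inv y ++ x)
    z~ = ~sym (~trans (++-congˡ (inv y) e) (cancelˡ y z))

  P-isP : ∀ s x → IsP s x (P s x)
  P-isP s x = isP (P-minimal s x) (R-parabolic s x) (PR-~ s x)

  coset-minimal-unique : ∀ {s x y z y′ z′} → Minimal (_≢ s) y → All (_≢ s) z → x ~ (y ++ z) →
    Minimal (_≢ s) y′ → All (_≢ s) z′ → x ~ (y′ ++ z′) → y ~ y′
  coset-minimal-unique {y = y} {z} {y′} {z′} my az e my′ az′ e′ = minimal-unique my my′ (Allₚ.++⁺ az (All-inv az′))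
    (~trans (~sym (cancelʳ y′ z′)) (~trans (++-congʳ (inv z′) (~trans (~sym e′) e)) (≡⇒~ (Listₚ.++-assoc y z (inv z′)))))

  isP⇒P : ∀ {s x y} → IsP s x y → y ~ P s x
  isP⇒P {s} {x} {y} (my , (z , z~ , az) , _) = coset-minimal-unique
    (λ t jt → my t jt _ _ (ℓ-HasLength y) (ℓ-HasLength (y ++ [ t ]))) az (~sym (~trans (++-congˡ y z~) (cancelˡ′ y x)))
    (P-minimal s x) (R-parabolic s x) (PR-~ s x)

  P-coset : ∀ {s x x′ g} → All (_≢ s) g → x′ ~ (x ++ g) → P s x ~ P s x′
  P-coset {s} {x} {x′} {g} ag e = coset-minimal-unique
    (P-minimal s x) (Allₚ.++⁺ (R-parabolic s x) ag) (~trans e (~trans (++-congʳ g (PR-~ s x)) (≡⇒~ (Listₚ.++-assoc (P s x) (R s x) g))))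
    (P-minimal s x′) (R-parabolic s x′) (PR-~ s x′)

  P-cong : ∀ {s x x′} → x ~ x′ → P s x ~ P s x′
  P-cong {x = x} e = P-coset [] (~trans (~sym e) (≡⇒~ (sym (Listₚ.++-identityʳ x))))

  coset-quotient : ∀ {s x x′} → P s x ~ P s x′ → ∃[ g ] (All (_≢ s) g × ((inv x ++ x′) ~ g))
  coset-quotient {s} {x} {x′} e = inv (R s x) ++ R s x′ , Allₚ.++⁺ (All-inv (R-parabolic s x)) (R-parabolic s x′)
    , ~trans (++-congʳ x′ (~trans (inv-cong (PR-~ s x)) (≡⇒~ (inv-++ (P s x) (R s x)))))
      (~trans (≡⇒~ (Listₚ.++-assoc (inv (R s x)) (inv (P s x)) x′))
        (++-congˡ (inv (R s x)) (~trans (++-congʳ x′ (inv-cong e)) (~trans (++-congˡ (inv (P s x′)) (PR-~ s x′)) (cancelˡ (P s x′) (R s x′))))))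

  P-minimal-length : ∀ {s w y z} → All (_≢ s) z → w ~ (y ++ z) → ℓ (P s w) ≤ ℓ y
  P-minimal-length {s} {w} {y} {z} az e = ℕₚ.≤-trans (ℕₚ.m≤m+n (ℓ (P s w)) _)
    (ℕₚ.≤-reflexive (sym (trans (ℓ-cong y~) (minimal-coset-length (P-minimal s w) (Allₚ.++⁺ (R-parabolic s w) (All-inv az))))))
    where
    y~ : y ~ (P s w ++ R s w ++ inv z)
    y~ = ~trans (~sym (cancelʳ y z)) (~trans (++-congʳ (inv z) (~trans (~sym e) (PR-~ s w))) (≡⇒~ (Listₚ.++-assoc (P s w) (R s w) (inv z))))

  -- The inverse of `w s` factors through the inverses of `R` and `P` and has a descent at `s`.
  -- Deleting a letter of the second factor by exchange places `w` in the coset of an element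
  -- shorter than `P s (w s)`.
  P-increases : ∀ {s w} → ℓ w < ℓ (w ++ [ s ]) → ℓ (P s w) < ℓ (P s (w ++ [ s ]))
  P-increases {s} {w} lt = conclude (exchange p x s (down⇒descent {p ++ x} down))
    where
    W = w ++ [ s ]
    p = inv (R s W)
    x = geo (inv (P s W))
    px~ : (p ++ x) ~ (s ∷ inv w)
    px~ = ~trans (++-congˡ p (geo-~ (inv (P s W)))) (~trans (≡⇒~ (sym (inv-++ (P s W) (R s W))))
      (~trans (inv-cong (~sym (PR-~ s W))) (≡⇒~ (inv-++ w [ s ]))))
    down : ℓ (s ∷ p ++ x) < ℓ (p ++ x)
    down = subst₂ _<_ (sym (trans (ℓ-cong (~sym (move-letter (~sym px~)))) (ℓ-inv w))) (trans (ℓ-snoc w s) (sym (ℓ-cong px~))) lt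
    -- The exchanged letter cannot lie in the parabolic factor of w s, because s does not.
    conclude : Descent Every p s ⊎ ∃[ x′ ] ((suc (length x′) ≡ length x) × ((s ∷ p ++ x) ~ (p ++ x′))) → ℓ (P s w) < ℓ (P s W)
    conclude (inj₁ d) = contradiction (d one one-positive)
      (not-both (parabolic-ascent (All-inv (R-parabolic s W)) (λ f → f refl) one one-positive))
    conclude (inj₂ (x′ , e , f)) = ℕₚ.≤-<-trans (P-minimal-length (R-parabolic s W) w~)
      (ℕₚ.≤-<-trans (ℓ≤length (inv x′)) (ℕₚ.≤-reflexive (trans (cong suc (Listₚ.length-reverse x′)) (trans e (ℓ-inv (P s W))))))
      where
      w~ : w ~ (inv x′ ++ R s W)
      w~ = ~trans (≡⇒~ (sym (inv-inv w))) (~trans (inv-cong (~trans (move-letter (~sym px~)) f))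
        (≡⇒~ (trans (inv-++ p x′) (cong (inv x′ ++_) (inv-inv (R s W))))))

  geo-avoids : ∀ {s x x′} → P s x ~ P s x′ → All (_≢ s) (geo (inv x ++ x′))
  geo-avoids {s} {x} {x′} e with coset-quotient {s} {x} {x′} e
  ... | g , ag , f = geodesic-letters (λ q ¬¬j r → ¬¬j λ j → j r) (geo (inv x ++ x′)) g
        (ℕₚ.≤-reflexive (ℓ-cong (~sym (geo-~ (inv x ++ x′))))) (~trans (geo-~ (inv x ++ x′)) f) ag

  -- A reduced word for `x⁻¹ x′` avoids every generator, hence is empty. This makes the facets of
  -- distinct elements distinct.
  P-separates : ∀ {x x′} → (∀ s → P s x ~ P s x′) → x ~ x′
  P-separates {x} {x′} same = inv⇒~ (trivial (geo (inv x ++ x′)) (geo-~ (inv x ++ x′)) λ s → geo-avoids (same s))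
    where
    trivial : ∀ y → y ~ (inv x ++ x′) → (∀ s → All (_≢ s) y) → (inv x ++ x′) ~ []
    trivial [] e _ = ~sym e
    trivial (s ∷ y) e avoid = contradiction refl (All.head (avoid s))

  -- Weak order intervals

  ≤R⇒ℓ : ∀ {x y} → x ≤R y → ℓ y ≡ ℓ x + ℓ (inv x ++ y)
  ≤R⇒ℓ (a , b , la , lb , lab) = trans (sym (HasLength-ℓ lab)) (cong₂ _+_ (HasLength-ℓ la) (HasLength-ℓ lb))

  ℓ-triangle : ∀ x y → ℓ y ≤ ℓ x + ℓ (inv x ++ y)
  ℓ-triangle x y = subst (_≤ ℓ x + ℓ (inv x ++ y)) (ℓ-cong (cancelˡ′ x y)) (ℓ-++-≤ x (inv x ++ y))

  ℓ⇒≤R : ∀ {x y} → ℓ x + ℓ (inv x ++ y) ≤ ℓ y → x ≤R y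
  ℓ⇒≤R {x} {y} le = ℓ x , ℓ (inv x ++ y) , ℓ-HasLength x , ℓ-HasLength (inv x ++ y)
    , subst (HasLength y) (ℕₚ.≤-antisym (ℓ-triangle x y) le) (ℓ-HasLength y)

  ≤R-cong : ∀ {x x′ y y′} → x ~ x′ → y ~ y′ → x ≤R y → x′ ≤R y′
  ≤R-cong {x} {x′} {y} {y′} e f p = ℓ⇒≤R (subst₂ _≤_
    (cong₂ _+_ (ℓ-cong e) (ℓ-cong (~trans (++-congʳ y (inv-cong e)) (++-congˡ (inv x′) f)))) (ℓ-cong f) (ℕₚ.≤-reflexive (sym (≤R⇒ℓ p))))

  ≤R-refl : ∀ x → x ≤R x
  ≤R-refl x = ℓ⇒≤R (ℕₚ.≤-reflexive (trans (cong (ℓ x +_) (trans (ℓ-cong (inverseˡ x)) ℓ-[])) (ℕₚ.+-identityʳ (ℓ x))))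

  infix 4 _≤R?_
  _≤R?_ : ∀ x y → Dec (x ≤R y)
  x ≤R? y with ℓ x + ℓ (inv x ++ y) ℕₚ.≤? ℓ y
  ... | yes p = yes (ℓ⇒≤R p)
  ... | no ¬p = no λ q → ¬p (ℕₚ.≤-reflexive (sym (≤R⇒ℓ q)))

  module Interval (u v : Word) where

    In : Word → Set
    In = InInterval u v

    In-cong : ∀ {x y} → x ~ y → In x → In y
    In-cong e (p , q) = ≤R-cong ~refl e p , ≤R-cong e ~refl q

    shift-snoc : ∀ w s → ℓ (inv (w ++ [ s ]) ++ v) ≤ suc (ℓ (inv w ++ v))
    shift-snoc w s = subst (λ e → ℓ (e ++ v) ≤ suc (ℓ (inv w ++ v))) (sym (inv-++ w [ s ])) (ℓ-∷-≤ s (inv w ++ v))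

    -- Lengths add in `w = u (u⁻¹ w)`, so a descent of the second factor is one of `w`, and the
    -- triangle inequality keeps both order relations tight.
    In-below : ∀ {w s} → In w → ℓ ((inv u ++ w) ++ [ s ]) < ℓ (inv u ++ w) → In (w ++ [ s ]) × (ℓ (w ++ [ s ]) < ℓ w)
    In-below {w} {s} (p , q) lt = (ℓ⇒≤R above-u , ℓ⇒≤R below-v) , ws<w
      where
      open ℕₚ.≤-Reasoning
      above-u : ℓ u + ℓ (inv u ++ w ++ [ s ]) ≤ ℓ (w ++ [ s ])
      above-u = ℕₚ.≤-pred (begin
        suc (ℓ u + ℓ (inv u ++ w ++ [ s ]))    ≡⟨ cong (λ e → suc (ℓ u + ℓ e)) (Listₚ.++-assoc (inv u) w [ s ]) ⟨
        suc (ℓ u + ℓ ((inv u ++ w) ++ [ s ]))  ≡⟨ ℕₚ.+-suc (ℓ u) _ ⟨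
        ℓ u + suc (ℓ ((inv u ++ w) ++ [ s ]))  ≤⟨ ℕₚ.+-monoʳ-≤ (ℓ u) lt ⟩
        ℓ u + ℓ (inv u ++ w)                   ≡⟨ ≤R⇒ℓ p ⟨
        ℓ w                                    ≤⟨ ℓ-≤-snoc w s ⟩
        suc (ℓ (w ++ [ s ]))                   ∎)
      ws<w : ℓ (w ++ [ s ]) < ℓ w
      ws<w = begin-strict
        ℓ (w ++ [ s ])                         ≤⟨ ℓ-triangle u (w ++ [ s ]) ⟩
        ℓ u + ℓ (inv u ++ w ++ [ s ])          ≡⟨ cong (λ e → ℓ u + ℓ e) (Listₚ.++-assoc (inv u) w [ s ]) ⟨
        ℓ u + ℓ ((inv u ++ w) ++ [ s ])        <⟨ ℕₚ.+-monoʳ-< (ℓ u) lt ⟩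
        ℓ u + ℓ (inv u ++ w)                   ≡⟨ ≤R⇒ℓ p ⟨
        ℓ w                                    ∎
      below-v : ℓ (w ++ [ s ]) + ℓ (inv (w ++ [ s ]) ++ v) ≤ ℓ v
      below-v = begin
        ℓ (w ++ [ s ]) + ℓ (inv (w ++ [ s ]) ++ v)  ≤⟨ ℕₚ.+-monoʳ-≤ (ℓ (w ++ [ s ])) (shift-snoc w s) ⟩
        ℓ (w ++ [ s ]) + suc (ℓ (inv w ++ v))       ≡⟨ ℕₚ.+-suc _ _ ⟩
        suc (ℓ (w ++ [ s ])) + ℓ (inv w ++ v)       ≤⟨ ℕₚ.+-monoˡ-≤ _ ws<w ⟩
        ℓ w + ℓ (inv w ++ v)                        ≡⟨ ≤R⇒ℓ q ⟨
        ℓ v                                         ∎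

    -- The first step of a saturated chain. As `w s g` is as long as possible, so are the
    -- intermediate products, which leaves `w s` between `w` and the end and lets the chain
    -- continue.
    In-chain : ∀ {w s g} → In w → In (w ++ s ∷ g) → ℓ w + suc (length g) ≤ ℓ (w ++ s ∷ g) →
      In (w ++ [ s ]) × (suc (ℓ w) ≤ ℓ (w ++ [ s ])) × (ℓ (w ++ [ s ]) + length g ≤ ℓ ((w ++ [ s ]) ++ g))
    In-chain {w} {s} {g} (p , _) (_ , q) long = (ℓ⇒≤R above-u , ℓ⇒≤R below-v) , up , long′
      where
      open ℕₚ.≤-Reasoning
      ws = w ++ [ s ]
      assoc : ws ++ g ≡ w ++ s ∷ g
      assoc = Listₚ.++-assoc w [ s ] g
      split : ℓ (w ++ s ∷ g) ≤ ℓ ws + length g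
      split = subst (λ e → ℓ e ≤ ℓ ws + length g) assoc (ℕₚ.≤-trans (ℓ-++-≤ ws g) (ℕₚ.+-monoʳ-≤ (ℓ ws) (ℓ≤length g)))
      up : suc (ℓ w) ≤ ℓ ws
      up = ℕₚ.+-cancelʳ-≤ (length g) _ _ (begin
        suc (ℓ w) + length g   ≡⟨ ℕₚ.+-suc (ℓ w) (length g) ⟨
        ℓ w + suc (length g)   ≤⟨ long ⟩
        ℓ (w ++ s ∷ g)         ≤⟨ split ⟩
        ℓ ws + length g        ∎)
      long′ : ℓ ws + length g ≤ ℓ (ws ++ g)
      long′ = begin
        ℓ ws + length g        ≤⟨ ℕₚ.+-monoˡ-≤ (length g) (ℓ-snoc-≤ w s) ⟩
        suc (ℓ w) + length g   ≡⟨ ℕₚ.+-suc (ℓ w) (length g) ⟨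
        ℓ w + suc (length g)   ≤⟨ long ⟩
        ℓ (w ++ s ∷ g)         ≡⟨ cong ℓ assoc ⟨
        ℓ (ws ++ g)            ∎
      above-u : ℓ u + ℓ (inv u ++ ws) ≤ ℓ ws
      above-u = begin
        ℓ u + ℓ (inv u ++ ws)              ≡⟨ cong (λ e → ℓ u + ℓ e) (Listₚ.++-assoc (inv u) w [ s ]) ⟨
        ℓ u + ℓ ((inv u ++ w) ++ [ s ])    ≤⟨ ℕₚ.+-monoʳ-≤ (ℓ u) (ℓ-snoc-≤ (inv u ++ w) s) ⟩
        ℓ u + suc (ℓ (inv u ++ w))         ≡⟨ ℕₚ.+-suc (ℓ u) _ ⟩
        suc (ℓ u + ℓ (inv u ++ w))         ≡⟨ cong suc (≤R⇒ℓ p) ⟨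
        suc (ℓ w)                          ≤⟨ up ⟩
        ℓ ws                               ∎
      rest : (inv ws ++ v) ~ (g ++ inv (w ++ s ∷ g) ++ v)
      rest = ~sym (~trans (≡⇒~ (cong (λ e → g ++ e ++ v) (trans (cong inv (sym assoc)) (inv-++ ws g))))
        (~trans (++-congˡ g (≡⇒~ (Listₚ.++-assoc (inv g) (inv ws) v))) (cancelˡ′ g (inv ws ++ v))))
      below-v : ℓ ws + ℓ (inv ws ++ v) ≤ ℓ v
      below-v = begin
        ℓ ws + ℓ (inv ws ++ v)                            ≡⟨ cong (ℓ ws +_) (ℓ-cong rest) ⟩
        ℓ ws + ℓ (g ++ inv (w ++ s ∷ g) ++ v)             ≤⟨ ℕₚ.+-monoʳ-≤ (ℓ ws) (ℓ-++-≤ g _) ⟩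
        ℓ ws + (ℓ g + ℓ (inv (w ++ s ∷ g) ++ v))          ≤⟨ ℕₚ.+-monoʳ-≤ (ℓ ws) (ℕₚ.+-monoˡ-≤ _ (ℓ≤length g)) ⟩
        ℓ ws + (length g + ℓ (inv (w ++ s ∷ g) ++ v))     ≡⟨ ℕₚ.+-assoc (ℓ ws) (length g) _ ⟨
        (ℓ ws + length g) + ℓ (inv (w ++ s ∷ g) ++ v)     ≤⟨ ℕₚ.+-monoˡ-≤ _ long′ ⟩
        ℓ (ws ++ g) + ℓ (inv (w ++ s ∷ g) ++ v)           ≡⟨ cong (λ e → ℓ e + ℓ (inv (w ++ s ∷ g) ++ v)) assoc ⟩
        ℓ (w ++ s ∷ g) + ℓ (inv (w ++ s ∷ g) ++ v)        ≡⟨ ≤R⇒ℓ q ⟨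
        ℓ v                                               ∎

    separating-descent : ∀ {w x} → In w → In x → ¬ (w ≤R x) →
      ∃[ s ] ((ℓ ((inv u ++ w) ++ [ s ]) < ℓ (inv u ++ w)) × ¬ (P s w ~ P s x))
    separating-descent {w} {x} (p , _) (q , _) w≰x with Finₚ.any? (λ s → (ℓ ((inv u ++ w) ++ [ s ]) ℕₚ.<? ℓ (inv u ++ w)) ×-dec ¬? (P s w ~? P s x))
    ... | yes found = found
    ... | no none = contradiction (ℓ⇒≤R (ℕₚ.≤-reflexive (sym lengths))) w≰x
      where
      a g : Word
      a = inv u ++ w
      g = geo (inv w ++ x)
      Up : Fin n → Set
      Up t = ℓ a < ℓ (a ++ [ t ])
      -- If a letter `t` were a descent of `a`, the absence of a separating descent would give
      -- `P t w ~ P t x`, and then `g` would avoid `t`.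
      letters : All Up g
      letters = All.tabulate λ {t} t∈g → decidable-stable (ℓ a ℕₚ.<? ℓ (a ++ [ t ])) λ ¬up →
        All.lookup (geo-avoids {t} {w} {x} (decidable-stable (P t w ~? P t x) λ ¬same →
          none (t , ℕₚ.≤∧≢⇒< (ℕₚ.≮⇒≥ ¬up) (ℓ-snoc-≢ a t) , ¬same))) t∈g refl
      ag~ : (a ++ g) ~ (inv u ++ x)
      ag~ = ~trans (≡⇒~ (Listₚ.++-assoc (inv u) w g)) (++-congˡ (inv u) (~trans (++-congˡ w (geo-~ (inv w ++ x))) (cancelˡ′ w x)))
      open ≡-Reasoning
      lengths : ℓ x ≡ ℓ w + ℓ (inv w ++ x)
      lengths = begin
        ℓ x                          ≡⟨ ≤R⇒ℓ q ⟩
        ℓ u + ℓ (inv u ++ x)         ≡⟨ cong (ℓ u +_) (ℓ-cong ag~) ⟨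
        ℓ u + ℓ (a ++ g)             ≡⟨ cong (ℓ u +_) (minimal-coset-length {Up} {a} {g} (λ _ up → up) letters) ⟩
        ℓ u + (ℓ a + ℓ g)            ≡⟨ ℕₚ.+-assoc (ℓ u) (ℓ a) (ℓ g) ⟨
        (ℓ u + ℓ a) + ℓ g            ≡⟨ cong₂ _+_ (sym (≤R⇒ℓ p)) (ℓ-cong (geo-~ (inv w ++ x))) ⟩
        ℓ w + ℓ (inv w ++ x)         ∎

-- Sorted enumerations without repetition

AllPairs-resp-↭ : ∀ {A : Set} {R : A → A → Set} → (∀ {x y} → R x y → R y x) → ∀ {xs ys} → xs ↭ ys → AllPairs R xs → AllPairs R ys
AllPairs-resp-↭ {A} {R} R-sym p = Permutationₛ.AllPairs-resp-↭ (setoid A) R-sym ((λ { refl r → r }) , (λ { refl r → r })) (↭⇒↭ₛ p)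

AllPairs-lookup : ∀ {A : Set} {R : A → A → Set} {xs} → AllPairs R xs → ∀ i j → i Fin.< j → R (lookup xs i) (lookup xs j)
AllPairs-lookup (px ∷ _)   Fin.zero    (Fin.suc j) _         = All.lookup px (Listₘ.∈-lookup j)
AllPairs-lookup (_ ∷ pxs) (Fin.suc i) (Fin.suc j) (s≤s i<j) = AllPairs-lookup pxs i j i<j

-- Used for the vertices, sorted by the length of the coset representative, and for the elements of
-- the interval, sorted by the sum of their labels.
record SortedEnumeration {A : Set} (_≈_ : A → A → Set) (μ : A → ℕ) (Q : A → Set) : Set where
  field
    size     : ℕ
    entry    : Fin size → A
    entry-Q  : ∀ i → Q (entry i)
    cover    : ∀ {x} → Q x → ∃[ i ] entry i ≈ x
    distinct : ∀ {i j} → i Fin.< j → ¬ (entry i ≈ entry j)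
    sorted   : ∀ {i j} → i Fin.< j → μ (entry i) ≤ μ (entry j)

  injective : (∀ {x y} → x ≈ y → y ≈ x) → ∀ {i j} → entry i ≈ entry j → i ≡ j
  injective ≈-sym {i} {j} e with Finₚ.<-cmp i j
  ... | tri< i<j _ _ = contradiction e (distinct i<j)
  ... | tri≈ _ i≡j _ = i≡j
  ... | tri> _ _ j<i = contradiction (≈-sym e) (distinct j<i)

sortedEnumeration : ∀ {A : Set} {_≈_ : A → A → Set} → IsDecEquivalence _≈_ → (μ : A → ℕ) {Q : A → Set} (xs : List A) →
  (∀ {x} → x List.∈ xs → Q x) → (∀ {x} → Q x → ∃[ y ] (y List.∈ xs × y ≈ x)) → SortedEnumeration _≈_ μ Q
sortedEnumeration {A} {_≈_} ≈-dec μ {Q} xs sound complete = record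
  { size     = length ys
  ; entry    = lookup ys
  ; entry-Q  = λ i → sound (Anyₚ.deduplicate⁻ _≟_ (∈-resp-↭ ys-↭ (Listₘ.∈-lookup i)))
  ; cover    = λ q → let y , y∈xs , y≈x = complete q; p = found y∈xs y≈x in Any.index p , Anyₚ.lookup-index p
  ; distinct = λ {i} {j} → AllPairs-lookup (AllPairs-resp-↭ (λ ne e → ne (≈-sym e)) (↭-sym ys-↭)
                 (deduplicate-! (record { isDecEquivalence = ≈-dec }) xs)) i j
  ; sorted   = λ {i} {j} → AllPairs-lookup (Linked⇒AllPairs ℕₚ.≤-trans (sort-↗ order (deduplicate _≟_ xs))) i j
  }
  where
  open IsDecEquivalence ≈-dec using (_≟_) renaming (sym to ≈-sym; trans to ≈-trans)
  order : DecTotalOrder _ _ _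
  order = On.decTotalOrder ℕₚ.≤-decTotalOrder μ
  ys : List A
  ys = sort order (deduplicate _≟_ xs)
  ys-↭ : ys ↭ deduplicate _≟_ xs
  ys-↭ = sort-↭ order (deduplicate _≟_ xs)
  found : ∀ {x y} → y List.∈ xs → y ≈ x → Any (_≈ x) ys
  found y∈xs y≈x = Any-resp-↭ (↭-sym ys-↭) (Anyₚ.deduplicate⁺ _≟_ (λ b≈a a≈x → ≈-trans b≈a a≈x)
    (Any.map (λ { refl → y≈x }) y∈xs))

-- The Gale order on increasing tuples

weight : ∀ {N k} → Vec (Fin N) k → ℕ
weight T = Vec.sum (Vec.map Fin.toℕ T)

Gale⇒weight : ∀ {N k} (T T′ : Vec (Fin N) k) → Gale T T′ → weight T ≤ weight T′
Gale⇒weight [] [] _ = z≤n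
Gale⇒weight (x ∷ T) (y ∷ T′) p = ℕₚ.+-mono-≤ (p Fin.zero) (Gale⇒weight T T′ (λ i → p (Fin.suc i)))

-- Strict monotonicity of the weight, by which sorting by weight gives a linear extension of the
-- Gale order.
Gale-weight-≡ : ∀ {N k} (T T′ : Vec (Fin N) k) → Gale T T′ → weight T′ ≤ weight T → T ≡ T′
Gale-weight-≡ [] [] _ _ = refl
Gale-weight-≡ (x ∷ T) (y ∷ T′) p le = cong₂ _∷_
  (Finₚ.≤-antisym (p Fin.zero) (ℕₚ.+-cancelʳ-≤ (weight T) _ _ (ℕₚ.≤-trans (ℕₚ.+-monoʳ-≤ (Fin.toℕ y) tails) le)))
  (Gale-weight-≡ T T′ (λ i → p (Fin.suc i)) (ℕₚ.+-cancelˡ-≤ (Fin.toℕ x) _ _ (ℕₚ.≤-trans (ℕₚ.+-monoˡ-≤ (weight T′) (p Fin.zero)) le)))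
  where
  tails : weight T ≤ weight T′
  tails = Gale⇒weight T T′ (λ i → p (Fin.suc i))

Increasing-tail : ∀ {N k x} {T : Vec (Fin N) k} → Increasing (x ∷ T) → Increasing T
Increasing-tail p i j i<j = p (Fin.suc i) (Fin.suc j) (s≤s i<j)

Increasing-head : ∀ {N k x y} {T : Vec (Fin N) k} → Increasing (x ∷ T) → y ∈ T → x Fin.< y
Increasing-head {x = x} {T = T} p y∈T = subst (x Fin.<_) (sym (VecAnyₚ.lookup-index y∈T)) (p Fin.zero (Fin.suc (VecAny.index y∈T)) (s≤s z≤n))

Increasing-unique : ∀ {N k} (T T′ : Vec (Fin N) k) → Increasing T → Increasing T′ →
  (∀ x → x ∈ T → x ∈ T′) → (∀ x → x ∈ T′ → x ∈ T) → T ≡ T′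
Increasing-unique [] [] _ _ _ _ = refl
Increasing-unique (x ∷ T) (y ∷ T′) p q to from with x≡y
  where
  x≡y : x ≡ y
  x≡y with to x (VecAny.here refl) | from y (VecAny.here refl)
  ... | VecAny.here e | _ = e
  ... | VecAny.there _ | VecAny.here e = sym e
  ... | VecAny.there x∈T′ | VecAny.there y∈T = contradiction (Increasing-head q x∈T′) (Finₚ.<-asym (Increasing-head p y∈T))
... | refl = cong (x ∷_) (Increasing-unique T T′ (Increasing-tail p) (Increasing-tail q)
      (λ z z∈T → behead p z∈T (to z (VecAny.there z∈T))) (λ z z∈T′ → behead q z∈T′ (from z (VecAny.there z∈T′))))
  where
  behead : ∀ {k l z} {U : Vec _ k} {U′ : Vec _ l} → Increasing (x ∷ U) → z ∈ U → z ∈ (x ∷ U′) → z ∈ U′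
  behead p z∈U (VecAny.here refl) = contradiction (Increasing-head p z∈U) (Finₚ.<-irrefl refl)
  behead p z∈U (VecAny.there z∈U′) = z∈U′

Increasing-fromList : ∀ {N} {xs : List (Fin N)} → AllPairs Fin._<_ xs → Increasing (fromList xs)
Increasing-fromList (px ∷ _) Fin.zero (Fin.suc j) _ = All.lookup px (∈-fromList⁻ (∈-lookup j _))
Increasing-fromList (_ ∷ pxs) (Fin.suc i) (Fin.suc j) (s≤s i<j) = Increasing-fromList pxs i j i<j

weight-fromList : ∀ {N} (xs : List (Fin N)) → weight (fromList xs) ≡ sum (map Fin.toℕ xs)
weight-fromList [] = refl
weight-fromList (x ∷ xs) = cong (Fin.toℕ x +_) (weight-fromList xs)

total : ∀ {N k} → (Fin k → Fin N) → ℕ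
total f = sum (map Fin.toℕ (tabulate f))

total-mono-≤ : ∀ {N k} (f g : Fin k → Fin N) → (∀ i → f i Fin.≤ g i) → total f ≤ total g
total-mono-≤ {k = zero} f g p = z≤n
total-mono-≤ {k = suc k} f g p = ℕₚ.+-mono-≤ (p Fin.zero) (total-mono-≤ (f ∘ Fin.suc) (g ∘ Fin.suc) (p ∘ Fin.suc))

total-mono-< : ∀ {N k} (f g : Fin k → Fin N) → (∀ i → f i Fin.≤ g i) → ∀ i → f i Fin.< g i → total f < total g
total-mono-< f g p Fin.zero q = ℕₚ.+-mono-<-≤ q (total-mono-≤ (f ∘ Fin.suc) (g ∘ Fin.suc) (p ∘ Fin.suc))
total-mono-< f g p (Fin.suc i) q = ℕₚ.+-mono-≤-< (p Fin.zero) (total-mono-< (f ∘ Fin.suc) (g ∘ Fin.suc) (p ∘ Fin.suc) i q)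

-- The Gale order compares sorted tuples, while a step in the weak order changes the label of one
-- generator. The field `weight-≡` lets one sum measure both.
record IncreasingImage {N k : ℕ} (f : Fin k → Fin N) : Set where
  field
    vector     : Vec (Fin N) k
    increasing : Increasing vector
    value-∈    : ∀ i → f i ∈ vector
    ∈-value    : ∀ {x} → x ∈ vector → ∃[ i ] f i ≡ x
    weight-≡   : weight vector ≡ total f

abstract
  increasingImage : ∀ {N k} (f : Fin k → Fin N) → (∀ {i j} → f i ≡ f j → i ≡ j) → IncreasingImage f
  increasingImage {N} {k} f f-injective = build sorted-values (trans (↭-length values-↭) (Listₚ.length-tabulate f)) values-↭ sorted-<
    where
    sorted-values : List (Fin N)
    sorted-values = sort (Finₚ.≤-decTotalOrder N) (tabulate f)
    values-↭ : sorted-values ↭ tabulate f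
    values-↭ = sort-↭ (Finₚ.≤-decTotalOrder N) (tabulate f)
    sorted-< : AllPairs Fin._<_ sorted-values
    sorted-< = AllPairs.zipWith (λ (le , ne) → Finₚ.≤∧≢⇒< le ne)
      (Linked⇒AllPairs Finₚ.≤-trans (sort-↗ (Finₚ.≤-decTotalOrder N) (tabulate f))
      , AllPairs-resp-↭ (λ ne e → ne (sym e)) (↭-sym values-↭) (Uniqueₚ.tabulate⁺ f-injective))
    build : ∀ xs → length xs ≡ k → xs ↭ tabulate f → AllPairs Fin._<_ xs → IncreasingImage f
    build xs refl p inc = record
      { vector     = fromList xs
      ; increasing = Increasing-fromList inc
      ; value-∈    = λ i → ∈-fromList⁺ (∈-resp-↭ (↭-sym p) (Listₘ.∈-tabulate⁺ i))
      ; ∈-value    = λ x∈ → let i , e = Listₘ.∈-tabulate⁻ (∈-resp-↭ p (∈-fromList⁻ x∈)) in i , sym e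
      ; weight-≡   = trans (weight-fromList xs) (sum-↭ (map⁺ Fin.toℕ p))
      }

words : ∀ {n} → ℕ → List (List (Fin n))
words zero    = [ [] ]
words (suc k) = [] ∷ cartesianProductWith _∷_ (allFin _) (words k)

words-complete : ∀ {n} k (w : List (Fin n)) → length w ≤ k → w List.∈ words k
words-complete zero [] _ = here refl
words-complete (suc k) [] _ = here refl
words-complete (suc k) (s ∷ w) (s≤s le) = there (Listₘ.∈-cartesianProductWith⁺ _∷_ (Listₘ.∈-allFin s) (words-complete k w le))

-- Labelling and shelling of the complex

module Shelling {n : ℕ} (M : Fin n → Fin n → ℕ) (isCoxeter : IsCoxeterMatrix M)
  (u v : Coxeter.Word M) (u≤v : Coxeter._≤R_ M u v) where
  open Coxeter M
  open CoxeterGroup M isCoxeter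
  open Interval u v

  In? : ∀ w → Dec (In w)
  In? w = (u ≤R? w) ×-dec (w ≤R? v)

  -- Elements of the interval have length at most `ℓ v`, so finitely many words suffice; repetitions
  -- up to `_~_` are removed by the enumeration.
  elements : List Word
  elements = filter In? (words (ℓ v))

  In⇒elements : ∀ {w} → In w → geo w List.∈ elements
  In⇒elements {w} i@(_ , w≤v) = Listₘ.∈-filter⁺ In? (words-complete (ℓ v) (geo w)
    (ℕₚ.≤-trans (ℕₚ.m≤m+n (ℓ w) _) (ℕₚ.≤-reflexive (sym (≤R⇒ℓ w≤v))))) (In-cong (~sym (geo-~ w)) i)

  elements⇒In : ∀ {w} → w List.∈ elements → In w
  elements⇒In w∈ = proj₂ (Listₘ.∈-filter⁻ In? {xs = words (ℓ v)} w∈)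

  ~-isDecEquivalence : IsDecEquivalence _~_
  ~-isDecEquivalence = record { isEquivalence = record { refl = ~refl ; sym = ~sym ; trans = ~trans } ; _≟_ = _~?_ }

  _≈_ : Word × Fin n → Word × Fin n → Set
  (y , s) ≈ (y′ , s′) = (y ~ y′) × (s ≡ s′)

  ≈-isDecEquivalence : IsDecEquivalence _≈_
  ≈-isDecEquivalence = ×-isDecEquivalence ~-isDecEquivalence (isDecEquivalence Finₚ._≟_)

  ≈-sym : ∀ {y s y′ s′} → (y , s) ≈ (y′ , s′) → (y′ , s′) ≈ (y , s)
  ≈-sym (e , f) = ~sym e , sym f

  ≈-trans : ∀ {y s y′ s′ y″ s″} → (y , s) ≈ (y′ , s′) → (y′ , s′) ≈ (y″ , s″) → (y , s) ≈ (y″ , s″)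
  ≈-trans (e , f) (e′ , f′) = ~trans e e′ , trans f f′

  Vertex : Word × Fin n → Set
  Vertex (y , s) = IsVertex u v y s

  P-vertex : ∀ {w} → In w → ∀ s → Vertex (P s w , s)
  P-vertex {w} i s = w , i , P-isP s w

  bottom : In u
  bottom = ≤R-refl u , u≤v

  abstract
    vertexEnumeration : SortedEnumeration _≈_ (λ (y , _) → ℓ y) Vertex
    vertexEnumeration = sortedEnumeration ≈-isDecEquivalence _ (cartesianProductWith vertex elements (allFin n)) sound complete
      where
      vertex : Word → Fin n → Word × Fin n
      vertex w s = P s w , s
      sound : ∀ {x} → x List.∈ cartesianProductWith vertex elements (allFin n) → Vertex x
      sound x∈ with Listₘ.∈-cartesianProductWith⁻ vertex elements (allFin n) x∈
      ... | w , s , w∈ , _ , refl = P-vertex (elements⇒In w∈) s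
      complete : ∀ {x} → Vertex x → ∃[ y ] (y List.∈ cartesianProductWith vertex elements (allFin n) × y ≈ x)
      complete {_ , s} (w , i , p) = vertex (geo w) s
        , Listₘ.∈-cartesianProductWith⁺ vertex (In⇒elements i) (Listₘ.∈-allFin s)
        , ~trans (P-cong (geo-~ w)) (~sym (isP⇒P p)) , refl

  module V = SortedEnumeration vertexEnumeration

  N : ℕ
  N = V.size

  abstract
    σ : Word → Fin n → Fin N
    σ y s with Finₚ.any? (λ k → IsDecEquivalence._≟_ ≈-isDecEquivalence (V.entry k) (y , s))
    ... | yes (k , _) = k
    -- A default for pairs that are no vertex: the index of the vertex of type `s` of `u`.
    ... | no _        = proj₁ (V.cover (P-vertex bottom s))

    entry-σ : ∀ {y s} → ∃[ k ] V.entry k ≈ (y , s) → V.entry (σ y s) ≈ (y , s)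
    entry-σ {y} {s} found with Finₚ.any? (λ k → IsDecEquivalence._≟_ ≈-isDecEquivalence (V.entry k) (y , s))
    ... | yes (_ , e) = e
    ... | no none     = contradiction found none

  σ-vertex : ∀ {y s} → IsVertex u v y s → V.entry (σ y s) ≈ (y , s)
  σ-vertex p = entry-σ (V.cover p)

  V-injective : ∀ {i j} → V.entry i ≈ V.entry j → i ≡ j
  V-injective = V.injective ≈-sym

  σ-cong : ∀ {y y′ s} → IsVertex u v y s → y ~ y′ → σ y s ≡ σ y′ s
  σ-cong {y} {y′} {s} p e = V-injective (≈-trans (σ-vertex p)
    (≈-trans (e , refl) (≈-sym (entry-σ (σ y s , ≈-trans (σ-vertex p) (e , refl))))))

  σ-injective : ∀ {y s y′ s′} → IsVertex u v y s → IsVertex u v y′ s′ → σ y s ≡ σ y′ s′ → (y ~ y′) × (s ≡ s′)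
  σ-injective p p′ e = ≈-trans (≈-sym (σ-vertex p)) (subst (λ k → V.entry k ≈ _) (sym e) (σ-vertex p′))

  σ-surjective : ∀ k → ∃[ y ] ∃[ s ] (IsVertex u v y s × (σ y s ≡ k))
  σ-surjective k = proj₁ (V.entry k) , proj₂ (V.entry k) , V.entry-Q k , V-injective (σ-vertex (V.entry-Q k))

  label : Word → Fin n → Fin N
  label w s = σ (P s w) s

  label-injective : ∀ {w x s t} → In w → In x → label w s ≡ label x t → (P s w ~ P t x) × (s ≡ t)
  label-injective i j = σ-injective (P-vertex i _) (P-vertex j _)

  label-cong : ∀ {w x s} → In w → P s w ~ P s x → label w s ≡ label x s
  label-cong i = σ-cong (P-vertex i _)

  label-< : ∀ {w x s} → In w → In x → ℓ (P s w) < ℓ (P s x) → label w s Fin.< label x s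
  label-< {w} {x} {s} i j lt with Finₚ.<-cmp (label w s) (label x s)
  ... | tri< p _ _ = p
  ... | tri≈ _ e _ = contradiction lt (ℕₚ.<-irrefl (ℓ-cong (proj₁ (label-injective i j e))))
  ... | tri> _ _ p = contradiction lt (ℕₚ.≤⇒≯ (subst₂ _≤_
        (ℓ-cong (proj₁ (σ-vertex (P-vertex j s)))) (ℓ-cong (proj₁ (σ-vertex (P-vertex i s)))) (V.sorted p)))

  height : Word → ℕ
  height w = total (label w)

  height-cong : ∀ {w x} → In w → w ~ x → height w ≡ height x
  height-cong {w} {x} i e = ℕₚ.≤-antisym (total-mono-≤ (label w) (label x) λ s → Finₚ.≤-reflexive (label-cong i (P-cong e)))
    (total-mono-≤ (label x) (label w) λ s → Finₚ.≤-reflexive (sym (label-cong i (P-cong e))))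

  height-< : ∀ {w s} → In w → In (w ++ [ s ]) → ℓ w < ℓ (w ++ [ s ]) → height w < height (w ++ [ s ])
  height-< {w} {s} i j lt = total-mono-< (label w) (label (w ++ [ s ])) weak s (label-< i j (P-increases lt))
    where
    weak : ∀ t → label w t Fin.≤ label (w ++ [ s ]) t
    weak t with s Finₚ.≟ t
    ... | yes refl = ℕₚ.<⇒≤ (label-< i j (P-increases lt))
    ... | no s≢t = Finₚ.≤-reflexive (label-cong i (P-coset (s≢t ∷ []) ~refl))

  height-chain : ∀ g {w} → In w → In (w ++ g) → ℓ w + length g ≤ ℓ (w ++ g) → height w + length g ≤ height (w ++ g)
  height-chain [] {w} i j _ = ℕₚ.≤-reflexive (trans (ℕₚ.+-identityʳ (height w)) (cong height (sym (Listₚ.++-identityʳ w))))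
  height-chain (s ∷ g) {w} i j long with In-chain {w} {s} {g} i j long
  ... | k , up , long′ = begin
    height w + suc (length g)          ≡⟨ ℕₚ.+-suc (height w) (length g) ⟩
    suc (height w) + length g          ≤⟨ ℕₚ.+-monoˡ-≤ (length g) (height-< i k up) ⟩
    height (w ++ [ s ]) + length g     ≤⟨ height-chain g k (subst In (sym (Listₚ.++-assoc w [ s ] g)) j) long′ ⟩
    height ((w ++ [ s ]) ++ g)         ≡⟨ cong height (Listₚ.++-assoc w [ s ] g) ⟩
    height (w ++ s ∷ g)                ∎
    where open ℕₚ.≤-Reasoning

  -- Going up from `w` to `x` raises the height by at least `ℓ (inv w ++ x)`, which must therefore
  -- be zero.
  height-≤R : ∀ {w x} → In w → In x → w ≤R x → height x ≤ height w → w ~ x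
  height-≤R {w} {x} i j w≤x le = inv⇒~ (ℓ≡0⇒~[] (ℕₚ.n≤0⇒n≡0 (ℕₚ.+-cancelˡ-≤ (height w) _ _ (begin
    height w + ℓ (inv w ++ x)   ≤⟨ height-chain g i (In-cong (~sym wg~x) j) (ℕₚ.≤-reflexive (trans (sym (≤R⇒ℓ w≤x)) (ℓ-cong (~sym wg~x)))) ⟩
    height (w ++ g)             ≡⟨ height-cong j (~sym wg~x) ⟨
    height x                    ≤⟨ le ⟩
    height w                    ≡⟨ ℕₚ.+-identityʳ (height w) ⟨
    height w + 0                ∎))))
    where
    open ℕₚ.≤-Reasoning
    g = geo (inv w ++ x)
    wg~x : (w ++ g) ~ x
    wg~x = ~trans (++-congˡ w (geo-~ (inv w ++ x))) (cancelˡ′ w x)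

  abstract
    elementEnumeration : SortedEnumeration _~_ height In
    elementEnumeration = sortedEnumeration ~-isDecEquivalence height elements elements⇒In
      λ {w} i → geo w , In⇒elements i , geo-~ w

  module F = SortedEnumeration elementEnumeration renaming (entry to element; entry-Q to element-In)
  open F using (element; element-In)

  abstract
    facet : ∀ i → IncreasingImage (label (element i))
    facet i = increasingImage (label (element i)) λ e → proj₂ (label-injective (element-In i) (element-In i) e)

  module Facet (i : Fin F.size) = IncreasingImage (facet i)

  C : Fin F.size → Vec (Fin N) n
  C = Facet.vector

  C-injective : ∀ i j → C i ≡ C j → i ≡ j
  C-injective i j e = F.injective ~sym (P-separates same)
    where
    same : ∀ s → P s (element i) ~ P s (element j)
    same s with Facet.∈-value j (subst (label (element i) s ∈_) e (Facet.value-∈ i s))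
    ... | t , f with label-injective (element-In j) (element-In i) f
    ... | g , refl = ~sym g

  label-FacetImage : ∀ {w} → In w → ∀ {s y} → IsP s w y → σ y s ≡ label w s
  label-FacetImage {w} i p = σ-cong (w , i , p) (isP⇒P p)

  C-FacetImage : ∀ i → FacetImage σ (element i) (C i)
  C-FacetImage i x = to , from
    where
    to : x ∈ C i → ∃[ s ] ∃[ y ] (IsP s (element i) y × (σ y s ≡ x))
    to x∈ with Facet.∈-value i x∈
    ... | s , e = s , P s (element i) , P-isP s (element i) , e
    from : ∃[ s ] ∃[ y ] (IsP s (element i) y × (σ y s ≡ x)) → x ∈ C i
    from (s , y , p , refl) = subst (_∈ C i) (sym (label-FacetImage (element-In i) p)) (Facet.value-∈ i s)

  C-cover : ∀ w T → In w → Increasing T → FacetImage σ w T → ∃[ i ] C i ≡ T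
  C-cover w T k inc image with F.cover k
  ... | i , e = i , Increasing-unique (C i) T (Facet.increasing i) inc to from
    where
    labels : ∀ s → label w s ≡ label (element i) s
    labels s = label-cong k (P-cong (~sym e))
    to : ∀ x → x ∈ C i → x ∈ T
    to x x∈ with Facet.∈-value i x∈
    ... | s , f = proj₂ (image x) (s , P s w , P-isP s w , trans (labels s) f)
    from : ∀ x → x ∈ T → x ∈ C i
    from x x∈ with proj₁ (image x) x∈
    ... | s , y , p , refl = subst (_∈ C i) (sym (trans (label-FacetImage k p) (labels s))) (Facet.value-∈ i s)

  -- An inversion would have weights sorted the other way, so the two tuples, and then the indices,
  -- would coincide.
  C-linear-extension : ∀ i j → Gale (C i) (C j) → i Fin.≤ j
  C-linear-extension i j gale with i Finₚ.≤? j
  ... | yes i≤j = i≤j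
  ... | no i≰j = contradiction (Finₚ.≤-reflexive (C-injective i j (Gale-weight-≡ (C i) (C j) gale
        (subst₂ _≤_ (sym (Facet.weight-≡ j)) (sym (Facet.weight-≡ i)) (F.sorted (ℕₚ.≰⇒> i≰j)))))) i≰j

  ∈-vector : ∀ {i w t} → In w → label w t ∈ C i → P t (element i) ~ P t w
  ∈-vector {i} w-In x∈ with Facet.∈-value i x∈
  ... | t′ , e with label-injective (element-In i) w-In e
  ... | f , refl = f

  module Adjacent (j r : Fin F.size) (s : Fin n) (r~ws : element r ~ (element j ++ [ s ]))
    (ws-In : In (element j ++ [ s ])) (ws<w : ℓ (element j ++ [ s ]) < ℓ (element j)) where

    w = element j
    z = element r
    ws = w ++ [ s ]
    back : w ~ (ws ++ [ s ])
    back = snoc-involution w s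
    up : ℓ ws < ℓ (ws ++ [ s ])
    up = subst (ℓ ws <_) (ℓ-cong back) ws<w
    lower : height z < height w
    lower = subst₂ _<_ (height-cong ws-In (~sym r~ws)) (sym (height-cong (element-In j) back)) (height-< ws-In (In-cong back (element-In j)) up)
    r<j : r Fin.< j
    r<j with Finₚ.<-cmp r j
    ... | tri< p _ _ = p
    ... | tri≈ _ refl _ = contradiction lower (ℕₚ.<-irrefl refl)
    ... | tri> _ _ p = contradiction lower (ℕₚ.≤⇒≯ (F.sorted p))
    b∉Cj : label z s ∉ C j
    -- Labels determine types, so only the vertex of type `s` could coincide, and its representative
    -- is strictly longer for `w` than for `w s`.
    b∉Cj b∈ = ℕₚ.<-irrefl (ℓ-cong (~trans (P-cong (~sym r~ws)) (~trans (~sym (∈-vector (element-In r) b∈)) (P-cong back)))) (P-increases up)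
    others : ∀ {t} → t ≢ s → label z t ≡ label w t
    others t≢s = label-cong (element-In r) (~sym (P-coset ((λ e → t≢s (sym e)) ∷ []) r~ws))
    symmetric-difference : IsSymDiff (C r) (C j) (label w s) (label z s)
    symmetric-difference x = to , from
      where
      to : x ∈ C r → Xor (x ∈ C j) ((x ≡ label w s) ⊎ (x ≡ label z s))
      to x∈ with Facet.∈-value r x∈
      ... | t , refl with t Finₚ.≟ s
      ...   | yes refl = inj₂ (b∉Cj , inj₂ refl)
      ...   | no t≢s = inj₁ (subst (_∈ C j) (sym (others t≢s)) (Facet.value-∈ j t) , λ
              { (inj₁ e) → t≢s (proj₂ (label-injective (element-In r) (element-In j) e))
              ; (inj₂ e) → t≢s (proj₂ (label-injective (element-In r) (element-In r) e)) })
      from : Xor (x ∈ C j) ((x ≡ label w s) ⊎ (x ≡ label z s)) → x ∈ C r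
      from (inj₂ (x∉ , inj₁ refl)) = contradiction (Facet.value-∈ j s) x∉
      from (inj₂ (x∉ , inj₂ refl)) = Facet.value-∈ r s
      from (inj₁ (x∈ , neither)) with Facet.∈-value j x∈
      ... | t , refl = subst (_∈ C r) (others (λ { refl → neither (inj₁ refl) })) (Facet.value-∈ r t)

  C-shelling : IsShellingOrder C
  C-shelling i j i<j =
    let s , down , apart = separating-descent (element-In j) (element-In i)
          -- By sorting, `element j` has at least the height of `element i`; lying below it in the
          -- weak order would make the two equal.
          (λ j≤i → F.distinct i<j (~sym (height-≤R (element-In j) (element-In i) j≤i (F.sorted i<j))))
        ws-In , ws<w = In-below (element-In j) down
        r , r~ws = F.cover ws-In
        open Adjacent j r s r~ws ws-In ws<w
    in r , r<j , label (element j) s , label (element r) s , symmetric-difference , Facet.value-∈ j s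
       , (λ a∈ → apart (~sym (∈-vector (element-In j) a∈))) , Facet.value-∈ r s , b∉Cj

  linearlyShellable : LinearlyShellable u v
  linearlyShellable = N , σ , (λ _ _ _ → σ-cong) , (λ _ _ _ _ → σ-injective) , σ-surjective
    , F.size , C , Facet.increasing , C-injective , (λ i → element i , element-In i , C-FacetImage i)
    , C-cover , C-linear-extension , C-shelling

theorem4p8 : (n : ℕ) (M : Fin n → Fin n → ℕ) → IsCoxeterMatrix M →
    (u v : Coxeter.Word M) → Coxeter._≤R_ M u v → Coxeter.LinearlyShellable M u v
theorem4p8 n M isCoxeter u v u≤v = Shelling.linearlyShellable M isCoxeter u v u≤v
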